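{- Let $n\ge 3$, let $\mathcal{D}$ be a dissection of a convex $n$-gon $P_n$ into $m$ pieces, and let $W_{\mathcal{D}}(x_1,\ldots,x_m)=(w_{i,j})_{1\le i,j\le n}$ be the associated weight matrix for the walks around $P_n$. Then $$\overline{w_{i,j}}=w_{j,i}\qquad\text{for all } 1\le i,j\le n,$$ i.e. $W_{\mathcal{D}}$ is a complementary symmetric matrix: $W_{\mathcal{D}}^t=\overline{W_{\mathcal{D}}}=(\overline{w_{i,j}})$.
   Context: $P_n$ is a convex $n$-gon ($n\ge3$) with vertices labelled $1,2,\ldots,n$ in counterclockwise order, labels being taken modulo $n$. A dissection $\mathcal{D}$ of $P_n$ is obtained by drawing $m-1$ ($m\ge 1$) pairwise noncrossing diagonals, which cut $P_n$ into $m$ polygons $\alpha_1,\ldots,\alpha_m$, called the pieces of the dissection; one writes $\mathcal{D}=\{\alpha_1,\ldots,\alpha_m\}$. If $\alpha_l$ has $d_l$ vertices, it is called a piece of degree $d_l$. For vertices $i,j$, a (counterclockwise) walk from $i$ to $j$ around $P_n$ is a sequence $w=(p_{i+1},p_{i+2},\ldots,p_{j-1})$ of pieces of $\mathcal{D}$, indexed by the vertices strictly between $i$ and $j$ when going counterclockwise from $i$ to $j$ (labels modulo $n$), such that: (i) $p_k$ is incident to vertex $k$ (i.e. $k$ is a vertex of $p_k$) for all $k\in\{i+1,\ldots,j-1\}$; (ii) each piece $\alpha\in\mathcal{D}$ of degree $d$ appears at most $d-2$ times among $p_{i+1},\ldots,p_{j-1}$. By convention, for $i=j$ there is no walk from $i$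 to $i$; for $j=i+1$ (modulo $n$) the empty sequence is the unique walk from $i$ to $i+1$. To each piece $\alpha_l$ an indeterminate $x_l=x(\alpha_l)$ is associated. The weight of a walk $w=(p_{i+1},\ldots,p_{j-1})$ is the monomial $x^w=\prod_{k=i+1}^{j-1}x(p_k)$ (the empty walk has weight $1$). The weight matrix $W_{\mathcal{D}}(x)=W_{\mathcal{D}}(x_1,\ldots,x_m)=(w_{i,j})_{1\le i,j\le n}$ has entries $w_{i,j}=\sum_{w} x^w\in\mathbb{Z}[x_1,\ldots,x_m]$, the sum over all walks $w$ from $i$ to $j$ (so $w_{i,i}=0$, $w_{i,i+1}=1$). Complementing map: let $\mathrm{Pol}_{\mathcal{D}}(x)=\{f\in\mathbb{Z}[x_1,\ldots,x_m]\mid \deg_{x_i} f\le d_i-2 \text{ for all } i\}$. The linear map $\phi_{\mathcal{D}}:\mathrm{Pol}_{\mathcal{D}}(x)\to\mathrm{Pol}_{\mathcal{D}}(x)$ is defined on monomials by $\phi_{\mathcal{D}}\left(\prod_{i=1}^m x_i^{a_i}\right)=\prod_{i=1}^m x_i^{d_i-2-a_i}$ and extended linearly. One writes $\bar f=\phi_{\mathcal{D}}(f)$. (By condition (ii), all $w_{i,j}$ lie in $\mathrm{Pol}_{\mathcal{D}}(x)$.) -}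

module Defs where

open import Data.Bool.Base using (if_then_else_)
open import Data.Empty using (⊥-elim)
open import Data.Fin.Base using (Fin; _<_; _≤_)
open import Data.Fin.Properties using (_≟_; _<?_; _≤?_; any?; all?)
open import Data.Fin.Subset using (Subset; ⊤; _∈_; _∩_; ∣_∣)
open import Data.Fin.Subset.Properties using (_∈?_)
open import Data.Integer.Base as ℤ using (ℤ; 0ℤ; 1ℤ)
open import Data.List.Base as List
  using (List; []; _∷_; _++_; allFin; concatMap; filter; foldl; foldr; length; map)
open import Data.List.Membership.Propositional as Mem using ()
open import Data.List.Membership.Propositional.Properties using (∈-filter⁻; ∈-map⁻)
open import Data.List.Relation.Binary.Pointwise as Pointwise using (Pointwise)
open import Data.List.Relation.Unary.All using (All)
open import Data.List.Relation.Unary.AllPairs using (AllPairs)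
open import Data.List.Relation.Unary.Any using (here; there)
open import Data.List.Relation.Unary.Unique.Propositional using (Unique)
open import Data.Nat.Base as ℕ using (ℕ; _∸_)
import Data.Nat.Properties as ℕₚ
open import Data.Product.Base using (_×_; _,_; proj₁; proj₂; ∃; Σ-syntax)
open import Data.Sum.Base using (_⊎_)
open import Data.Vec.Base as Vec using (Vec; lookup; replicate; tabulate; zipWith)
open import Data.Vec.Properties using (≡-dec; lookup-zipWith; lookup-replicate; lookup∘tabulate)
open import Relation.Binary.PropositionalEquality
  using (_≡_; _≢_; refl; sym; trans; cong₂; subst)
open import Relation.Nullary using (¬_; Dec; does; yes; no)
open import Relation.Nullary.Decidable using (_×-dec_; _⊎-dec_; ¬?)

-- The vertices of P_n, in counterclockwise order, are the elements
-- 0, 1, …, n-1 of Fin n.  A polygon inscribed in P_n is given by its set of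
-- vertices.

Polygon : ℕ → Set
Polygon n = Subset n

-- The pair (a , b) with a < b stands for the segment joining a and b.

Segment : ℕ → Set
Segment n = Fin n × Fin n

-- A segment with a < b is a diagonal of Q if a and b are vertices of Q that
-- are not adjacent in Q, i.e. Q has a vertex strictly on either side of it.
-- (The condition a < b is implied by the third component.)

IsDiagonalOf : ∀ {n} → Polygon n → Segment n → Set
IsDiagonalOf Q (a , b) =
    a ∈ Q
  × b ∈ Q
  × ∃ (λ k → k ∈ Q × a < k × k < b)
  × ∃ (λ k → k ∈ Q × (k < a ⊎ b < k))

isDiagonalOf? : ∀ {n} (Q : Polygon n) (s : Segment n) → Dec (IsDiagonalOf Q s)
isDiagonalOf? Q (a , b) =
        (a ∈? Q)
  ×-dec (b ∈? Q)
  ×-dec any? (λ k → (k ∈? Q) ×-dec (a <? k) ×-dec (k <? b))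
  ×-dec any? (λ k → (k ∈? Q) ×-dec ((k <? a) ⊎-dec (b <? k)))

-- Two segments cross if they meet in a point interior to both.

Crossing : ∀ {n} → Segment n → Segment n → Set
Crossing (a , b) (c , d) = (a < c × c < b × b < d) ⊎ (c < a × a < d × d < b)

record Dissection (n : ℕ) : Set where
  field
    diagonals   : List (Segment n)
    areDiagonal : All (IsDiagonalOf ⊤) diagonals
    distinct    : Unique diagonals
    noncrossing : AllPairs (λ s t → ¬ Crossing s t) diagonals

inner outer : ∀ {n} → Segment n → Subset n
inner (a , b) = tabulate λ k → does ((a ≤? k) ×-dec (k ≤? b))
outer (a , b) = tabulate λ k → does ((k ≤? a) ⊎-dec (b ≤? k))

-- Drawing a segment cuts the polygon of which it is a diagonal into two
-- polygons and leaves every other polygon untouched.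

cut : ∀ {n} → Segment n → Polygon n → List (Polygon n)
cut s Q = if does (isDiagonalOf? Q s)
          then Q ∩ inner s ∷ Q ∩ outer s ∷ []
          else Q ∷ []

Monomial : ℕ → Set
Monomial m = Vec ℕ m

one : ∀ {m} → Monomial m
one = replicate _ 0

x : ∀ {m} → Fin m → Monomial m
x l = tabulate λ k → if does (k ≟ l) then 1 else 0

infixl 7 _·_
_·_ : ∀ {m} → Monomial m → Monomial m → Monomial m
_·_ = zipWith ℕ._+_

-- ℤ[x₁,…,xₘ] as the free ℤ-module on the monomials: a polynomial is written
-- as a formal sum of terms c · μ (monomials may repeat), and two such sums are
-- identified by _≈_ when all their coefficients agree.

Poly : ℕ → Set
Poly m = List (ℤ × Monomial m)

𝟘 : ∀ {m} → Poly m
𝟘 = []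

infixl 6 _⊕_
_⊕_ : ∀ {m} → Poly m → Poly m → Poly m
_⊕_ = _++_

⟦_⟧ : ∀ {m} → Monomial m → Poly m
⟦ μ ⟧ = (1ℤ , μ) ∷ []

coeff : ∀ {m} → Poly m → Monomial m → ℤ
coeff []            ν = 0ℤ
coeff ((c , μ) ∷ f) ν =
  if does (≡-dec ℕₚ._≟_ μ ν) then c ℤ.+ coeff f ν else coeff f ν

infix 4 _≈_
_≈_ : ∀ {m} → Poly m → Poly m → Set
f ≈ g = ∀ ν → coeff f ν ≡ coeff g ν

DegreesBoundedBy : ∀ {m} → (Fin m → ℕ) → Poly m → Set
DegreesBoundedBy b f = ∀ μ → coeff f μ ≢ 0ℤ → ∀ l → lookup μ l ℕ.≤ b l

coeff≢0⇒term : ∀ {m} (f : Poly m) {ν} → coeff f ν ≢ 0ℤ →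
               ∃ λ t → t Mem.∈ f × proj₂ t ≡ ν
coeff≢0⇒term [] c≢0 = ⊥-elim (c≢0 refl)
coeff≢0⇒term ((c , μ) ∷ f) {ν} c≢0 with ≡-dec ℕₚ._≟_ μ ν
... | yes μ≡ν = (c , μ) , here refl , μ≡ν
... | no  _   with coeff≢0⇒term f c≢0
...   | t , t∈f , eq = t , there t∈f , eq

-- The vertices i+1, …, j-1 strictly between i and j, going counterclockwise
-- from i to j (for i ≢ j), in this order.

arc : ∀ {n} → Fin n → Fin n → List (Fin n)
arc {n} i j =
  if does (i <? j)
  then filter (λ k → (i <? k) ×-dec (k <? j)) (allFin n)
  else filter (i <?_) (allFin n) ++ filter (_<? j) (allFin n)

sequences : (m r : ℕ) → List (List (Fin m))
sequences m ℕ.zero    = [] ∷ []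
sequences m (ℕ.suc r) = concatMap (λ l → map (l ∷_) (sequences m r)) (allFin m)

occurrences : ∀ {m} → Fin m → List (Fin m) → ℕ
occurrences l p = length (filter (l ≟_) p)

module _ {n : ℕ} (D : Dissection n) where

  open Dissection D

  pieces : List (Polygon n)
  pieces = foldl (λ Qs s → concatMap (cut s) Qs) (⊤ ∷ []) diagonals

  #pieces : ℕ
  #pieces = length pieces

  Piece : Set
  Piece = Fin #pieces

  piece : Piece → Polygon n
  piece = List.lookup pieces

  degree : Piece → ℕ
  degree l = ∣ piece l ∣

  IsWalk : Fin n → Fin n → List Piece → Set
  IsWalk i j p =
      i ≢ j
    × Pointwise (λ k l → k ∈ piece l) (arc i j) p
    × (∀ l → occurrences l p ℕ.≤ degree l ∸ 2)

  isWalk? : ∀ i j p → Dec (IsWalk i j p)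
  isWalk? i j p =
          ¬? (i ≟ j)
    ×-dec Pointwise.decidable (λ k l → k ∈? piece l) (arc i j) p
    ×-dec all? (λ l → occurrences l p ℕₚ.≤? degree l ∸ 2)

  walks : Fin n → Fin n → List (List Piece)
  walks i j = filter (isWalk? i j) (sequences #pieces (length (arc i j)))

  weight : List Piece → Monomial #pieces
  weight = foldr (λ l μ → x l · μ) one

  w : Fin n → Fin n → Poly #pieces
  w i j = foldr (λ p f → ⟦ weight p ⟧ ⊕ f) 𝟘 (walks i j)

  Pol : Set
  Pol = Σ[ f ∈ Poly #pieces ] DegreesBoundedBy (λ l → degree l ∸ 2) f

  complement : Monomial #pieces → Monomial #pieces
  complement μ = tabulate λ l → degree l ∸ 2 ∸ lookup μ l

  -- Terms of f outside the degree bound, on which _∸_ truncates, may occur,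
  -- but by the bound they cancel in f, hence also in φ f.

  φ : Pol → Pol
  φ (f , _) = map complementTerm f , bounded
    where
    complementTerm : ℤ × Monomial #pieces → ℤ × Monomial #pieces
    complementTerm (c , μ) = c , complement μ

    bounded : DegreesBoundedBy (λ l → degree l ∸ 2) (map complementTerm f)
    bounded μ c≢0 l with coeff≢0⇒term (map complementTerm f) c≢0
    ... | t , t∈ , refl with ∈-map⁻ complementTerm t∈
    ...   | (_ , ν) , _ , refl =
      subst (ℕ._≤ degree l ∸ 2)
        (sym (lookup∘tabulate (λ k → degree k ∸ 2 ∸ lookup ν k) l))
        (ℕₚ.m∸n≤m (degree l ∸ 2) (lookup ν l))

  lookup-weight : ∀ p l → lookup (weight p) l ≡ occurrences l p
  lookup-weight []      l = lookup-replicate l 0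
  lookup-weight (k ∷ p) l = trans
    (lookup-zipWith ℕ._+_ l (x k) (weight p))
    (trans (cong₂ ℕ._+_ (lookup∘tabulate _ l) (lookup-weight p l)) step)
    where
    step : (if does (l ≟ k) then 1 else 0) ℕ.+ occurrences l p
           ≡ occurrences l (k ∷ p)
    step with l ≟ k
    ... | yes _ = refl
    ... | no  _ = refl

  w-bounded : ∀ i j → DegreesBoundedBy (λ l → degree l ∸ 2) (w i j)
  w-bounded i j μ c≢0 l with coeff≢0⇒term (w i j) c≢0
  ... | t , t∈w , refl with term⇒walk (walks i j) t∈w
    where
    term⇒walk : ∀ ps {t} →
      t Mem.∈ foldr (λ p f → ⟦ weight p ⟧ ⊕ f) 𝟘 ps →
      ∃ λ p → p Mem.∈ ps × proj₂ t ≡ weight p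
    term⇒walk (p ∷ ps) (here refl) = p , here refl , refl
    term⇒walk (p ∷ ps) (there t∈) with term⇒walk ps t∈
    ... | q , q∈ , eq = q , there q∈ , eq
  ...   | p , p∈ , refl = subst (ℕ._≤ degree l ∸ 2) (sym (lookup-weight p l))
                            (proj₂ (proj₂ isWalk) l)
    where
    isWalk : IsWalk i j p
    isWalk = proj₂ (∈-filter⁻ (isWalk? i j) {xs = sequences _ (length (arc i j))} p∈)

  W : Fin n → Fin n → Pol
  W i j = w i j , w-bounded i j

{-# OPTIONS --safe #-}

-- The coefficient of μ in w i j counts the assignments of incident pieces to
-- the vertices of the arc from i to j that use the l-th piece μ l times.  Cut
-- P_n along a diagonal ab into Q₁ and Q₂ and induct on the number of
-- diagonals.  If i and j both lie in Q₁, one of the two arcs avoids Q₂ and the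
-- other contains all vertices of Q₂ besides a and b; these use up the pieces
-- of Q₂, so that both counts reduce to Q₁.  If i and j are separated by ab,
-- say with b on the arc from i to j, then b takes its piece from either side,
-- and w i j = w₁ i a · w₂ b j + w₁ i b · w₂ a j, whose summands are
-- exchanged by complementation with those of w j i.
module Submission where

open import Defs
open import Data.Bool.Base using (Bool; true; false; _∧_; _∨_; _xor_; not; if_then_else_; T)
open import Data.Bool.ListAction using (all; and)
open import Data.Bool.Properties using (T-≡; T?; ∧-assoc; ∧-comm; ∧-zeroʳ)
open import Data.Empty using (⊥-elim)
open import Data.Fin.Base using (Fin; zero; suc; toℕ; fromℕ<)
open import Data.Fin.Patterns using (0F; 1F; 2F; 3F; 4F)
import Data.Fin.Properties as Finₚ
open import Data.Fin.Subset as Subset using (_∩_; ∣_∣)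
open import Data.Fin.Subset.Properties using (_∈?_)
open import Data.Integer.Base as ℤ using (0ℤ; 1ℤ)
import Data.Integer.Properties as ℤₚ
open import Data.List.Base as List
  using (List; []; _∷_; _++_; allFin; concatMap; filter; filterᵇ; foldl; foldr; length; map)
open import Data.List.Membership.Propositional using (_∈_)
open import Data.List.Membership.Propositional.Properties using (∈-allFin; ∈-filter⁺)
open import Data.List.Properties
  using (++-identityʳ; concatMap-++; concatMap-pure; filter-none; length-++; map-++; map-tabulate; map-∘)
open import Data.List.Relation.Binary.Permutation.Propositional as Perm
  using (_↭_; prep; ↭-refl; ↭-reflexive; ↭-sym; ↭-trans)
import Data.List.Relation.Binary.Permutation.Propositional.Properties as Permₚ
open import Data.List.Relation.Binary.Pointwise as Pointwise using (Pointwise)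
open import Data.List.Relation.Unary.All as All using (All; []; _∷_)
import Data.List.Relation.Unary.All.Properties as Allₚ
open import Data.List.Relation.Unary.AllPairs using ([]; _∷_)
open import Data.List.Relation.Unary.Any using (here; there)
open import Data.List.Relation.Unary.Unique.Propositional using (Unique)
import Data.List.Relation.Unary.Unique.Propositional.Properties as Uniqueₚ
open import Data.Nat.Base
  using (ℕ; zero; suc; _+_; _*_; _∸_; _≤_; _<_; _<ᵇ_; _≤ᵇ_; z≤n; s≤s)
open import Data.Nat.ListAction using (sum)
open import Data.Nat.ListAction.Properties using (sum-++)
open import Data.Nat.Properties
open import Algebra.Properties.CommutativeSemigroup +-commutativeSemigroup using (interchange)
open import Algebra.Properties.CommutativeSemigroup *-commutativeSemigroup
  using (x∙yz≈y∙xz; x∙yz≈yx∙z)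
open import Data.Product.Base using (_×_; _,_; proj₁; proj₂; ∃; ∃₂)
open import Data.Sum.Base using (_⊎_; inj₁; inj₂)
open import Data.Unit.Base using (⊤; tt)
open import Data.Vec.Base as Vec using (Vec; []; _∷_; lookup; tabulate)
open import Data.Vec.Properties
  using (≡-dec; []=⇒lookup; lookup-replicate; lookup-zipWith; lookup∘tabulate; tabulate-cong; tabulate∘lookup)
open import Function.Base using (_∘_; const; id)
open import Function.Bundles using (Equivalence; _⇔_; mk⇔)
open import Relation.Binary.Definitions using (tri<; tri≈; tri>) renaming (Decidable to Decidable₂)
open import Relation.Binary.PropositionalEquality hiding ([_])
open import Relation.Nullary using (Dec; does; yes; no; ¬_)
open import Relation.Nullary.Decidable using (_×-dec_; decidable-stable; does-⇔)
open import Relation.Unary using (Pred; Decidable)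
open ≡-Reasoning

-- Assignments of pieces to vertices

-- The claim is proved for every polygon inscribed in P_n, with arcs restricted to its vertices.
-- That the vertices of Q₂ besides a and b use up the pieces of Q₂ is the claim for Q₂ at the pair
-- a, b itself: they are adjacent in Q₂, so one arc is empty and has product 1; by complementation
-- the monomial with all exponents maximal occurs in the product over the other arc, and comparing
-- degrees shows that nothing is left over. Condition (ii) on walks is read off from the exponents
-- of the monomial whose coefficient is taken. Since the factors of a product commute, arcs matter
-- only up to permutation. Each decomposition of an arc thus becomes a Boolean statement about the
-- relative position of at most five vertices, which is settled by evaluating it on all weak orders
-- of five elements.

∑ : ∀ {a} {A : Set a} → List A → (A → ℕ) → ℕ
∑ xs f = sum (map f xs)

module _ {a} {A : Set a} where

  ∑-congᴬ : ∀ {f g : A → ℕ} {xs} → All (λ x → f x ≡ g x) xs → ∑ xs f ≡ ∑ xs g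
  ∑-congᴬ []       = refl
  ∑-congᴬ (e ∷ es) = cong₂ _+_ e (∑-congᴬ es)

  ∑-cong : ∀ (xs : List A) {f g} → (∀ x → f x ≡ g x) → ∑ xs f ≡ ∑ xs g
  ∑-cong xs f≗g = ∑-congᴬ (All.universal f≗g xs)

  ∑-++ : ∀ xs ys (f : A → ℕ) → ∑ (xs ++ ys) f ≡ ∑ xs f + ∑ ys f
  ∑-++ xs ys f = trans (cong sum (map-++ f xs ys)) (sum-++ (map f xs) _)

  ∑-map : ∀ {b} {B : Set b} (g : B → A) xs (f : A → ℕ) → ∑ (map g xs) f ≡ ∑ xs (f ∘ g)
  ∑-map g xs f = cong sum (sym (map-∘ xs))

  ∑-0 : ∀ (xs : List A) → ∑ xs (λ _ → 0) ≡ 0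
  ∑-0 []       = refl
  ∑-0 (_ ∷ xs) = ∑-0 xs

  ∑-+ : ∀ xs (f g : A → ℕ) → ∑ xs (λ x → f x + g x) ≡ ∑ xs f + ∑ xs g
  ∑-+ []       f g = refl
  ∑-+ (x ∷ xs) f g =
    trans (cong (f x + g x +_) (∑-+ xs f g)) (interchange (f x) (g x) _ _)

  ∑-*ˡ : ∀ k xs (f : A → ℕ) → ∑ xs (λ x → k * f x) ≡ k * ∑ xs f
  ∑-*ˡ k []       f = sym (*-zeroʳ k)
  ∑-*ˡ k (x ∷ xs) f =
    trans (cong (k * f x +_) (∑-*ˡ k xs f)) (sym (*-distribˡ-+ k (f x) _))

  ∑-*ʳ : ∀ k xs (f : A → ℕ) → ∑ xs (λ x → f x * k) ≡ ∑ xs f * k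
  ∑-*ʳ k xs f =
    trans (∑-cong xs (λ x → *-comm (f x) k)) (trans (∑-*ˡ k xs f) (*-comm k _))

∑-swap : ∀ {a b} {A : Set a} {B : Set b} xs ys (f : A → B → ℕ) →
         ∑ xs (λ x → ∑ ys (f x)) ≡ ∑ ys (λ y → ∑ xs (λ x → f x y))
∑-swap []       ys f = sym (∑-0 ys)
∑-swap (x ∷ xs) ys f =
  trans (cong (∑ ys (f x) +_) (∑-swap xs ys f)) (sym (∑-+ ys (f x) _))

∑-concatMap : ∀ {a b} {A : Set a} {B : Set b} (g : A → List B) xs (f : B → ℕ) →
              ∑ (List.concatMap g xs) f ≡ ∑ xs (λ x → ∑ (g x) f)
∑-concatMap g []       f = refl
∑-concatMap g (x ∷ xs) f =
  trans (∑-++ (g x) _ f) (cong (∑ (g x) f +_) (∑-concatMap g xs f))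

[_] : Bool → ℕ
[ b ] = if b then 1 else 0

-- Defined by recursion rather than as `[ does (d ≟ e) ]`, so that it reduces on constructors; `δ-≟`
-- links the two forms.
δ₁ : ℕ → ℕ → ℕ
δ₁ zero    zero    = 1
δ₁ zero    (suc _) = 0
δ₁ (suc _) zero    = 0
δ₁ (suc m) (suc n) = δ₁ m n

δ : ∀ {m} → Monomial m → Monomial m → ℕ
δ []      []      = 1
δ (d ∷ μ) (e ∷ ν) = δ₁ d e * δ μ ν

δ₁-refl : ∀ n → δ₁ n n ≡ 1
δ₁-refl zero    = refl
δ₁-refl (suc n) = δ₁-refl n

δ₁-+ˡ : ∀ n k → δ₁ n (suc k + n) ≡ 0
δ₁-+ˡ zero    k = refl
δ₁-+ˡ (suc n) k = trans (cong (δ₁ n) (+-suc k n)) (δ₁-+ˡ n k)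

δ₁-+ʳ : ∀ n k → δ₁ (suc k + n) n ≡ 0
δ₁-+ʳ zero    k = refl
δ₁-+ʳ (suc n) k = trans (cong (λ m → δ₁ m n) (+-suc k n)) (δ₁-+ʳ n k)

-- Between pairs of equal sum, agreement in one entry forces agreement in the other. With `a` and
-- `b` the lengths of two opposite arcs, this is complementarity for a single polygon.
δ₁-complement : ∀ e e′ a b → e + e′ ≡ a + b → δ₁ e a ≡ δ₁ e′ b
δ₁-complement zero    e′ zero    b refl = sym (δ₁-refl b)
δ₁-complement zero    e′ (suc a) b refl = sym (δ₁-+ʳ b a)
δ₁-complement (suc e) e′ zero    b refl = sym (δ₁-+ˡ e′ e)
δ₁-complement (suc e) e′ (suc a) b eq   = δ₁-complement e e′ a b (suc-injective eq)

-- A list with at most one entry: a sum over it is a term guarded by incidence and by a use being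
-- left.
preds : Bool → ℕ → List ℕ
preds true  (suc e) = e ∷ []
preds _     _       = []

∑-preds-swap : ∀ b b′ e (f : ℕ → ℕ) →
  ∑ (preds b e) (λ d → ∑ (preds b′ d) f) ≡ ∑ (preds b′ e) (λ d → ∑ (preds b d) f)
∑-preds-swap false false e f = refl
∑-preds-swap true  true  e f = refl
∑-preds-swap false true  e f = sym (∑-0 (preds true e))
∑-preds-swap true  false e f = ∑-0 (preds true e)

module _ {n : ℕ} where

  -- An exponent vector indexed by the list of pieces itself, so that it splits along `++` without
  -- arithmetic on lengths.
  Usage : List (Polygon n) → Set
  Usage L = All (λ _ → ℕ) L

  total : ∀ {L} → Usage L → ℕ
  total []      = 0
  total (e ∷ μ) = e + total μ

  δ₀ : ∀ {L} → Usage L → ℕ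
  δ₀ []      = 1
  δ₀ (e ∷ μ) = δ₁ 0 e * δ₀ μ

  -- One step of an assignment: v takes an incident piece, whose number of
  -- remaining uses drops by one.
  uses : ∀ (L : List (Polygon n)) → Fin n → Usage L → List (Usage L)
  uses []      v []      = []
  uses (Q ∷ L) v (e ∷ μ) = map (_∷ μ) (preds (lookup Q v) e) ++ map (e ∷_) (uses L v μ)

  -- The coefficient of μ in ∏_{v ∈ S} ∑_{Q ∈ L, v ∈ Q} x(Q).
  count : ∀ (L : List (Polygon n)) → Usage L → List (Fin n) → ℕ
  count L μ []      = δ₀ μ
  count L μ (v ∷ S) = ∑ (uses L v μ) (λ μ′ → count L μ′ S)

  ∑-uses-∷ : ∀ Q L v e (μ : Usage L) f →
    ∑ (uses (Q ∷ L) v (e ∷ μ)) f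
    ≡ ∑ (preds (lookup Q v) e) (λ e′ → f (e′ ∷ μ)) + ∑ (uses L v μ) (λ μ′ → f (e ∷ μ′))
  ∑-uses-∷ Q L v e μ f =
    trans (∑-++ (map (_∷ μ) (preds (lookup Q v) e)) _ f)
          (cong₂ _+_ (∑-map (_∷ μ) (preds (lookup Q v) e) f) (∑-map (e ∷_) (uses L v μ) f))

  -- Sort the pairs of steps by which of them take `Q`. Both: `∑-preds-swap`. Exactly one: the two
  -- mixed sums trade places. None: induction.
  ∑-uses-swap : ∀ L u v (μ : Usage L) f →
    ∑ (uses L u μ) (λ μ′ → ∑ (uses L v μ′) f) ≡ ∑ (uses L v μ) (λ μ′ → ∑ (uses L u μ′) f)
  ∑-uses-swap []      u v []      f = refl
  ∑-uses-swap (Q ∷ L) u v (e ∷ μ) f = begin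
    ∑ (uses (Q ∷ L) u (e ∷ μ)) (λ μ′ → ∑ (uses (Q ∷ L) v μ′) f)
      ≡⟨ expand u v ⟩
    (PP u v + PU u v) + (PU v u + UU u v)
      ≡⟨ cong₂ _+_ (+-comm (PP u v) _) (+-comm (PU v u) _) ⟩
    (PU u v + PP u v) + (UU u v + PU v u)
      ≡⟨ interchange (PU u v) _ _ _ ⟩
    (PU u v + UU u v) + (PP u v + PU v u)
      ≡⟨ +-comm (PU u v + UU u v) _ ⟩
    (PP u v + PU v u) + (PU u v + UU u v)
      ≡⟨ cong₂ (λ p q → (p + PU v u) + (PU u v + q))
           (∑-preds-swap (lookup Q u) (lookup Q v) e (λ d → f (d ∷ μ)))
           (∑-uses-swap L u v μ (λ μ′ → f (e ∷ μ′))) ⟩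
    (PP v u + PU v u) + (PU u v + UU v u)
      ≡⟨ sym (expand v u) ⟩
    ∑ (uses (Q ∷ L) v (e ∷ μ)) (λ μ′ → ∑ (uses (Q ∷ L) u μ′) f) ∎
    where
    P : Fin n → ℕ → List ℕ
    P w = preds (lookup Q w)
    PP PU UU : Fin n → Fin n → ℕ
    PP s t = ∑ (P s e) (λ d → ∑ (P t d) (λ d′ → f (d′ ∷ μ)))
    PU s t = ∑ (P s e) (λ d → ∑ (uses L t μ) (λ μ′ → f (d ∷ μ′)))
    UU s t = ∑ (uses L s μ) (λ μ′ → ∑ (uses L t μ′) (λ μ″ → f (e ∷ μ″)))
    expand : ∀ s t → ∑ (uses (Q ∷ L) s (e ∷ μ)) (λ μ′ → ∑ (uses (Q ∷ L) t μ′) f)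
                   ≡ (PP s t + PU s t) + (PU t s + UU s t)
    expand s t = begin
      ∑ (uses (Q ∷ L) s (e ∷ μ)) (λ μ′ → ∑ (uses (Q ∷ L) t μ′) f)
        ≡⟨ ∑-uses-∷ Q L s e μ _ ⟩
      ∑ (P s e) (λ d → ∑ (uses (Q ∷ L) t (d ∷ μ)) f)
        + ∑ (uses L s μ) (λ μ′ → ∑ (uses (Q ∷ L) t (e ∷ μ′)) f)
        ≡⟨ cong₂ _+_ (∑-cong (P s e) (λ d → ∑-uses-∷ Q L t d μ f))
                     (∑-cong (uses L s μ) (λ μ′ → ∑-uses-∷ Q L t e μ′ f)) ⟩
      ∑ (P s e) (λ d → ∑ (P t d) (λ d′ → f (d′ ∷ μ)) + ∑ (uses L t μ) (λ μ′ → f (d ∷ μ′)))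
        + ∑ (uses L s μ) (λ μ′ → ∑ (P t e) (λ d → f (d ∷ μ′))
                                  + ∑ (uses L t μ′) (λ μ″ → f (e ∷ μ″)))
        ≡⟨ cong₂ _+_ (∑-+ (P s e) _ _) (∑-+ (uses L s μ) _ _) ⟩
      (PP s t + PU s t) + (∑ (uses L s μ) (λ μ′ → ∑ (P t e) (λ d → f (d ∷ μ′))) + UU s t)
        -- The terms in which only `t` takes `Q` must appear as `PU t s`, which sums over the
        -- predecessors of `e` first.
        ≡⟨ cong (λ k → (PP s t + PU s t) + (k + UU s t)) (∑-swap (uses L s μ) (P t e) _) ⟩
      (PP s t + PU s t) + (PU t s + UU s t) ∎

  -- The factors of the product commute. Arcs may therefore be listed in whatever order filtering
  -- produces.
  count-↭ : ∀ {L} {S T : List (Fin n)} → S ↭ T → ∀ μ → count L μ S ≡ count L μ T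
  count-↭         Perm.refl          μ = refl
  count-↭ {L}     (Perm.prep v p)    μ = ∑-cong (uses L v μ) (count-↭ p)
  count-↭ {L} {S = _ ∷ _ ∷ S} (Perm.swap u v p) μ =
    trans (∑-uses-swap L u v μ (λ ν → count L ν S))
          (∑-cong (uses L v μ) (λ μ′ → ∑-cong (uses L u μ′) (count-↭ p)))
  count-↭         (Perm.trans p q)   μ = trans (count-↭ p μ) (count-↭ q μ)

  Avoids : List (Polygon n) → Fin n → Set
  Avoids L v = All (λ Q → lookup Q v ≡ false) L

  uses-avoids : ∀ {L v} → Avoids L v → ∀ μ → uses L v μ ≡ []
  uses-avoids []            []      = refl
  uses-avoids (v∉Q ∷ avoid) (e ∷ μ)
    rewrite v∉Q | uses-avoids avoid μ = refl

  uses-exhausted : ∀ L v (μ : Usage L) → total μ ≡ 0 → uses L v μ ≡ []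
  uses-exhausted []      v []         Σμ≡0 = refl
  uses-exhausted (Q ∷ L) v (zero ∷ μ) Σμ≡0 rewrite uses-exhausted L v μ Σμ≡0 with lookup Q v
  ... | true  = refl
  ... | false = refl

  total-uses : ∀ L v (μ : Usage L) →
             All (λ μ′ → suc (total μ′) ≡ total μ) (uses L v μ)
  total-uses []      v []      = []
  total-uses (Q ∷ L) v (e ∷ μ) = Allₚ.++⁺ (Allₚ.map⁺ (sum-preds (lookup Q v) e))
    (Allₚ.map⁺ (All.map (λ {μ′} eq → trans (sym (+-suc e (total μ′))) (cong (e +_) eq))
                        (total-uses L v μ)))
    where
    sum-preds : ∀ b e → All (λ d → suc (d + total μ) ≡ e + total μ) (preds b e)
    sum-preds false e       = []
    sum-preds true  zero    = []
    sum-preds true  (suc e) = refl ∷ []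

  total≡0⇒δ₀≡1 : ∀ {L} (μ : Usage L) → total μ ≡ 0 → δ₀ μ ≡ 1
  total≡0⇒δ₀≡1 []         _    = refl
  total≡0⇒δ₀≡1 (zero ∷ μ) Σμ≡0 = trans (+-identityʳ _) (total≡0⇒δ₀≡1 μ Σμ≡0)

  -- The product is homogeneous: each vertex contributes one indeterminate, and by `total-uses` each
  -- step lowers the total by one.
  count≢0⇒degree : ∀ L μ S → count L μ S ≢ 0 → total μ ≡ length S
  count≢0⇒degree L μ [] ≢0 = δ₀≢0⇒total≡0 μ ≢0
    where
    δ₀≢0⇒total≡0 : ∀ {L} (μ : Usage L) → δ₀ μ ≢ 0 → total μ ≡ 0
    δ₀≢0⇒total≡0 []          _  = refl
    δ₀≢0⇒total≡0 (zero ∷ μ)  ≢0 = δ₀≢0⇒total≡0 μ (≢0 ∘ trans (+-identityʳ _))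
    δ₀≢0⇒total≡0 (suc e ∷ μ) ≢0 with () ← ≢0 refl
  count≢0⇒degree L μ (v ∷ S) ≢0 with nonzero-term (total-uses L v μ) ≢0
    where
    nonzero-term : ∀ {P : Usage L → Set} {xs} {f : Usage L → ℕ} →
                   All P xs → ∑ xs f ≢ 0 → ∃ λ x → P x × f x ≢ 0
    nonzero-term [] ≢0 with () ← ≢0 refl
    nonzero-term {f = f} (_∷_ {x} px pxs) ≢0 with f x in eq
    ... | zero  = nonzero-term pxs ≢0
    ... | suc _ = x , px , λ fx≡0 → 1+n≢0 (trans (sym eq) fx≡0)
  ... | μ′ , eq , ≢0′ = trans (sym eq) (cong suc (count≢0⇒degree L μ′ S ≢0′))

  -- Splitting the pieces into two lists

  infixr 5 _⊞_
  _⊞_ : ∀ {L₁ L₂} → Usage L₁ → Usage L₂ → Usage (L₁ ++ L₂)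
  _⊞_ = Allₚ.++⁺

  ⊞-surjective : ∀ L₁ {L₂} (μ : Usage (L₁ ++ L₂)) → ∃₂ λ (μ₁ : Usage L₁) (μ₂ : Usage L₂) → μ ≡ μ₁ ⊞ μ₂
  ⊞-surjective []       μ       = [] , μ , refl
  ⊞-surjective (_ ∷ L₁) (e ∷ μ) with μ₁ , μ₂ , refl ← ⊞-surjective L₁ μ = e ∷ μ₁ , μ₂ , refl

  δ₀-⊞ : ∀ {L₁ L₂} (μ₁ : Usage L₁) (μ₂ : Usage L₂) → δ₀ (μ₁ ⊞ μ₂) ≡ δ₀ μ₁ * δ₀ μ₂
  δ₀-⊞ []       μ₂ = sym (+-identityʳ _)
  δ₀-⊞ (e ∷ μ₁) μ₂ = trans (cong (δ₁ 0 e *_) (δ₀-⊞ μ₁ μ₂)) (sym (*-assoc (δ₁ 0 e) _ _))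

  ∑-uses-⊞ : ∀ L₁ {L₂} v μ₁ μ₂ f →
    ∑ (uses (L₁ ++ L₂) v (μ₁ ⊞ μ₂)) f
    ≡ ∑ (uses L₁ v μ₁) (λ μ′ → f (μ′ ⊞ μ₂)) + ∑ (uses L₂ v μ₂) (λ μ′ → f (μ₁ ⊞ μ′))
  ∑-uses-⊞ []       v []       μ₂ f = refl
  ∑-uses-⊞ (Q ∷ L₁) {L₂} v (e ∷ μ₁) μ₂ f = begin
    ∑ (uses (Q ∷ L₁ ++ L₂) v (e ∷ μ₁ ⊞ μ₂)) f
      ≡⟨ ∑-uses-∷ Q (L₁ ++ L₂) v e (μ₁ ⊞ μ₂) f ⟩
    p + ∑ (uses (L₁ ++ L₂) v (μ₁ ⊞ μ₂)) (λ μ′ → f (e ∷ μ′))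
      ≡⟨ cong (p +_) (∑-uses-⊞ L₁ v μ₁ μ₂ (λ μ′ → f (e ∷ μ′))) ⟩
    p + (q + r)
      ≡⟨ sym (+-assoc p q r) ⟩
    (p + q) + r
      ≡⟨ cong (_+ r) (sym (∑-uses-∷ Q L₁ v e μ₁ (λ μ′ → f (μ′ ⊞ μ₂)))) ⟩
    ∑ (uses (Q ∷ L₁) v (e ∷ μ₁)) (λ μ′ → f (μ′ ⊞ μ₂)) + r ∎
    where
    p q r : ℕ
    p = ∑ (preds (lookup Q v) e) (λ e′ → f (e′ ∷ μ₁ ⊞ μ₂))
    q = ∑ (uses L₁ v μ₁) (λ μ′ → f (e ∷ μ′ ⊞ μ₂))
    r = ∑ (uses L₂ v μ₂) (λ μ′ → f (e ∷ μ₁ ⊞ μ′))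

  count-swap : ∀ L₁ {L₂} μ₁ μ₂ S →
    count (L₁ ++ L₂) (μ₁ ⊞ μ₂) S ≡ count (L₂ ++ L₁) (μ₂ ⊞ μ₁) S
  count-swap L₁ {L₂} μ₁ μ₂ [] =
    trans (δ₀-⊞ μ₁ μ₂)
          (trans (*-comm (δ₀ μ₁) _) (sym (δ₀-⊞ μ₂ μ₁)))
  count-swap L₁ {L₂} μ₁ μ₂ (v ∷ S) = begin
    ∑ (uses (L₁ ++ L₂) v (μ₁ ⊞ μ₂)) (λ μ′ → count (L₁ ++ L₂) μ′ S)
      ≡⟨ ∑-uses-⊞ L₁ {L₂} v μ₁ μ₂ _ ⟩
    ∑ (uses L₁ v μ₁) _ + ∑ (uses L₂ v μ₂) _
      ≡⟨ cong₂ _+_ (∑-cong (uses L₁ v μ₁) (λ μ′ → count-swap L₁ μ′ μ₂ S))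
                   (∑-cong (uses L₂ v μ₂) (λ μ′ → count-swap L₁ μ₁ μ′ S)) ⟩
    ∑ (uses L₁ v μ₁) _ + ∑ (uses L₂ v μ₂) _
      ≡⟨ +-comm (∑ (uses L₁ v μ₁) _) _ ⟩
    ∑ (uses L₂ v μ₂) _ + ∑ (uses L₁ v μ₁) _
      ≡⟨ sym (∑-uses-⊞ L₂ {L₁} v μ₂ μ₁ _) ⟩
    ∑ (uses (L₂ ++ L₁) v (μ₂ ⊞ μ₁)) (λ μ′ → count (L₂ ++ L₁) μ′ S) ∎

  module _ {L₁ L₂ : List (Polygon n)} where

    count-∷ˡ : ∀ {v} → Avoids L₂ v → ∀ μ₁ μ₂ S →
      count (L₁ ++ L₂) (μ₁ ⊞ μ₂) (v ∷ S)
      ≡ ∑ (uses L₁ v μ₁) (λ μ′ → count (L₁ ++ L₂) (μ′ ⊞ μ₂) S)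
    count-∷ˡ {v} v∉L₂ μ₁ μ₂ S =
      trans (∑-uses-⊞ L₁ {L₂} v μ₁ μ₂ _)
            (trans (cong (λ us → ∑ (uses L₁ v μ₁) _ + ∑ us _) (uses-avoids v∉L₂ μ₂))
                   (+-identityʳ _))

    count-∷ʳ : ∀ {v} → Avoids L₁ v → ∀ μ₁ μ₂ S →
      count (L₁ ++ L₂) (μ₁ ⊞ μ₂) (v ∷ S)
      ≡ ∑ (uses L₂ v μ₂) (λ μ′ → count (L₁ ++ L₂) (μ₁ ⊞ μ′) S)
    count-∷ʳ {v} v∉L₁ μ₁ μ₂ S =
      trans (∑-uses-⊞ L₁ {L₂} v μ₁ μ₂ _)
            (cong (λ us → ∑ us _ + ∑ (uses L₂ v μ₂) _) (uses-avoids v∉L₁ μ₁))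

    count-++ : ∀ {S T} → All (Avoids L₂) S → All (Avoids L₁) T → ∀ μ₁ μ₂ →
      count (L₁ ++ L₂) (μ₁ ⊞ μ₂) (S ++ T) ≡ count L₁ μ₁ S * count L₂ μ₂ T
    count-++ {[]} {[]} [] [] μ₁ μ₂ = δ₀-⊞ μ₁ μ₂
    count-++ {[]} {v ∷ T} [] (v∉ ∷ T∉) μ₁ μ₂ = begin
      count (L₁ ++ L₂) (μ₁ ⊞ μ₂) (v ∷ T)
        ≡⟨ count-∷ʳ v∉ μ₁ μ₂ T ⟩
      ∑ (uses L₂ v μ₂) (λ μ′ → count (L₁ ++ L₂) (μ₁ ⊞ μ′) T)
        ≡⟨ ∑-cong (uses L₂ v μ₂) (count-++ [] T∉ μ₁) ⟩
      ∑ (uses L₂ v μ₂) (λ μ′ → δ₀ μ₁ * count L₂ μ′ T)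
        ≡⟨ ∑-*ˡ (δ₀ μ₁) (uses L₂ v μ₂) _ ⟩
      δ₀ μ₁ * count L₂ μ₂ (v ∷ T) ∎
    count-++ {v ∷ S} {T} (v∉ ∷ S∉) T∉ μ₁ μ₂ = begin
      count (L₁ ++ L₂) (μ₁ ⊞ μ₂) (v ∷ S ++ T)
        ≡⟨ count-∷ˡ v∉ μ₁ μ₂ (S ++ T) ⟩
      ∑ (uses L₁ v μ₁) (λ μ′ → count (L₁ ++ L₂) (μ′ ⊞ μ₂) (S ++ T))
        ≡⟨ ∑-cong (uses L₁ v μ₁) (λ μ′ → count-++ S∉ T∉ μ′ μ₂) ⟩
      ∑ (uses L₁ v μ₁) (λ μ′ → count L₁ μ′ S * count L₂ μ₂ T)
        ≡⟨ ∑-*ʳ (count L₂ μ₂ T) (uses L₁ v μ₁) _ ⟩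
      count L₁ μ₁ (v ∷ S) * count L₂ μ₂ T ∎

    -- Only `v`, in practice an end of the diagonal, can draw from both lists. Once its choice is
    -- fixed, what remains is a product of polynomials in disjoint sets of indeterminates.
    count-shared : ∀ {v S T} → All (Avoids L₂) S → All (Avoids L₁) T → ∀ μ₁ μ₂ →
      count (L₁ ++ L₂) (μ₁ ⊞ μ₂) (v ∷ S ++ T)
      ≡ count L₁ μ₁ (v ∷ S) * count L₂ μ₂ T + count L₁ μ₁ S * count L₂ μ₂ (v ∷ T)
    count-shared {v} {S} {T} S∉ T∉ μ₁ μ₂ = begin
      count (L₁ ++ L₂) (μ₁ ⊞ μ₂) (v ∷ S ++ T)
        ≡⟨ ∑-uses-⊞ L₁ {L₂} v μ₁ μ₂ _ ⟩
      ∑ (uses L₁ v μ₁) (λ μ′ → count (L₁ ++ L₂) (μ′ ⊞ μ₂) (S ++ T))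
        + ∑ (uses L₂ v μ₂) (λ μ′ → count (L₁ ++ L₂) (μ₁ ⊞ μ′) (S ++ T))
        ≡⟨ cong₂ _+_
             (trans (∑-cong (uses L₁ v μ₁) (λ μ′ → count-++ S∉ T∉ μ′ μ₂))
                    (∑-*ʳ (count L₂ μ₂ T) (uses L₁ v μ₁) _))
             (trans (∑-cong (uses L₂ v μ₂) (count-++ S∉ T∉ μ₁))
                    (∑-*ˡ (count L₁ μ₁ S) (uses L₂ v μ₂) _)) ⟩
      count L₁ μ₁ (v ∷ S) * count L₂ μ₂ T + count L₁ μ₁ S * count L₂ μ₂ (v ∷ T) ∎

    -- The vertices in T already use up all pieces of L₂.
    count-saturated : ∀ {T} → All (Avoids L₁) T → ∀ S μ₁ μ₂ → total μ₂ ≤ length T →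
      count (L₁ ++ L₂) (μ₁ ⊞ μ₂) (T ++ S) ≡ count L₁ μ₁ S * count L₂ μ₂ T
    count-saturated {[]} [] [] μ₁ μ₂ _ = δ₀-⊞ μ₁ μ₂
    count-saturated {[]} [] (v ∷ S) μ₁ μ₂ Σ≤0 = begin
      count (L₁ ++ L₂) (μ₁ ⊞ μ₂) (v ∷ S)
        ≡⟨ ∑-uses-⊞ L₁ {L₂} v μ₁ μ₂ _ ⟩
      ∑ (uses L₁ v μ₁) (λ μ′ → count (L₁ ++ L₂) (μ′ ⊞ μ₂) S) + ∑ (uses L₂ v μ₂) _
        ≡⟨ cong₂ (λ s us → s + ∑ us _)
             (∑-cong (uses L₁ v μ₁) (λ μ′ → count-saturated [] S μ′ μ₂ Σ≤0))
             -- The hypothesis now reads `total μ₂ ≤ 0`: even if `v` is incident to a piece of `L₂`,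
             -- no use of that piece is left.
             (uses-exhausted L₂ v μ₂ (n≤0⇒n≡0 Σ≤0)) ⟩
      ∑ (uses L₁ v μ₁) (λ μ′ → count L₁ μ′ S * δ₀ μ₂) + 0
        ≡⟨ +-identityʳ _ ⟩
      ∑ (uses L₁ v μ₁) (λ μ′ → count L₁ μ′ S * δ₀ μ₂)
        ≡⟨ ∑-*ʳ (δ₀ μ₂) (uses L₁ v μ₁) _ ⟩
      count L₁ μ₁ (v ∷ S) * δ₀ μ₂ ∎
    count-saturated {v ∷ T} (v∉ ∷ T∉) S μ₁ μ₂ Σ≤ = begin
      count (L₁ ++ L₂) (μ₁ ⊞ μ₂) (v ∷ T ++ S)
        ≡⟨ count-∷ʳ v∉ μ₁ μ₂ (T ++ S) ⟩
      ∑ (uses L₂ v μ₂) (λ μ′ → count (L₁ ++ L₂) (μ₁ ⊞ μ′) (T ++ S))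
        ≡⟨ ∑-congᴬ (All.map
             (λ {μ′} eq → count-saturated T∉ S μ₁ μ′ (≤-pred (≤-trans (≤-reflexive eq) Σ≤)))
             (total-uses L₂ v μ₂)) ⟩
      ∑ (uses L₂ v μ₂) (λ μ′ → count L₁ μ₁ S * count L₂ μ′ T)
        ≡⟨ ∑-*ˡ (count L₁ μ₁ S) (uses L₂ v μ₂) _ ⟩
      count L₁ μ₁ S * count L₂ μ₂ (v ∷ T) ∎

  -- Complementary exponents and balanced arcs

  Complementary : (L : List (Polygon n)) → Usage L → Usage L → Set
  Complementary []      _       _       = ⊤
  Complementary (Q ∷ L) (d ∷ μ) (e ∷ ν) = d + e ≡ ∣ Q ∣ ∸ 2 × Complementary L μ ν

  Complementary-sym : ∀ L {μ ν} → Complementary L μ ν → Complementary L ν μ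
  Complementary-sym []      {[]}    {[]}    _          = tt
  Complementary-sym (Q ∷ L) {d ∷ μ} {e ∷ ν} (eq , com) =
    trans (+-comm e d) eq , Complementary-sym L com

  Complementary-⊞⁻ : ∀ L₁ {L₂} μ₁ {μ₂} ν₁ {ν₂} →
    Complementary (L₁ ++ L₂) (μ₁ ⊞ μ₂) (ν₁ ⊞ ν₂) →
    Complementary L₁ μ₁ ν₁ × Complementary L₂ μ₂ ν₂
  Complementary-⊞⁻ []       []       []       com        = tt , com
  Complementary-⊞⁻ (_ ∷ L₁) (d ∷ μ₁) (e ∷ ν₁) (eq , com)
    with com₁ , com₂ ← Complementary-⊞⁻ L₁ μ₁ ν₁ com = (eq , com₁) , com₂

  Complementary-⊞⁺ : ∀ L₁ {L₂} μ₁ {μ₂} ν₁ {ν₂} →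
    Complementary L₁ μ₁ ν₁ → Complementary L₂ μ₂ ν₂ →
    Complementary (L₁ ++ L₂) (μ₁ ⊞ μ₂) (ν₁ ⊞ ν₂)
  Complementary-⊞⁺ []       []       []       _           com₂ = com₂
  Complementary-⊞⁺ (_ ∷ L₁) (d ∷ μ₁) (e ∷ ν₁) (eq , com₁) com₂ =
    eq , Complementary-⊞⁺ L₁ μ₁ ν₁ com₁ com₂

  full : (L : List (Polygon n)) → Usage L
  full []      = []
  full (Q ∷ L) = (∣ Q ∣ ∸ 2) ∷ full L

  none : (L : List (Polygon n)) → Usage L
  none []      = []
  none (Q ∷ L) = 0 ∷ none L

  total-none : ∀ L → total (none L) ≡ 0
  total-none []      = refl
  total-none (_ ∷ L) = total-none L

  none-full : ∀ L → Complementary L (none L) (full L)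
  none-full []      = tt
  none-full (_ ∷ L) = refl , none-full L

  Complementary⇒sum≤ : ∀ L μ ν → Complementary L μ ν → total ν ≤ total (full L)
  Complementary⇒sum≤ []      []      []      _          = z≤n
  Complementary⇒sum≤ (Q ∷ L) (d ∷ μ) (e ∷ ν) (eq , com) =
    +-mono-≤ (≤-trans (m≤n+m e d) (≤-reflexive eq)) (Complementary⇒sum≤ L μ ν com)

  -- Coefficientwise form of the assertion that complementation takes the product over `A` to the
  -- product over `B`. As a record it lets unification read `L`, `A` and `B` off the type.
  record Balanced (L : List (Polygon n)) (A B : List (Fin n)) : Set where
    constructor balanced
    field balance : ∀ μ ν → Complementary L μ ν → count L μ A ≡ count L ν B

  open Balanced public

  module _ {L : List (Polygon n)} where

    Balanced-sym : ∀ {A B} → Balanced L A B → Balanced L B A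
    balance (Balanced-sym bal) μ ν com = sym (balance bal ν μ (Complementary-sym L com))

    Balanced-↭ : ∀ {A A′ B B′} → A ↭ A′ → B ↭ B′ → Balanced L A′ B′ → Balanced L A B
    balance (Balanced-↭ A↭ B↭ bal) μ ν com =
      trans (count-↭ A↭ μ) (trans (balance bal μ ν com) (sym (count-↭ B↭ ν)))

    -- The empty product has constant term 1. By balance the monomial `full L` has coefficient 1
    -- over `B`, so homogeneity makes its degree, the sum of the `∣ Q ∣ ∸ 2`, equal to `length B`.
    Balanced-[]⇒sum≤ : ∀ {B} → Balanced L [] B → ∀ {μ ν} → Complementary L μ ν →
                       total ν ≤ length B
    Balanced-[]⇒sum≤ {B} bal {μ} {ν} com = ≤-trans (Complementary⇒sum≤ L μ ν com)
      (≤-reflexive (count≢0⇒degree L (full L) B (λ ≡0 → 1+n≢0 (begin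
        1                  ≡⟨ sym (total≡0⇒δ₀≡1 (none L) (total-none L)) ⟩
        count L (none L) []     ≡⟨ balance bal (none L) (full L) (none-full L) ⟩
        count L (full L) B ≡⟨ ≡0 ⟩
        0                  ∎))))

  -- Reading a diagonal from its other end exchanges its two sides, while the list of pieces keeps
  -- its order.
  Balanced-swap : ∀ {L₁ L₂ A B} → Balanced (L₁ ++ L₂) A B → Balanced (L₂ ++ L₁) A B
  balance (Balanced-swap {L₁} {L₂} {A} {B} bal) μ ν com
    with μ₂ , μ₁ , refl ← ⊞-surjective L₂ {L₁} μ
       | ν₂ , ν₁ , refl ← ⊞-surjective L₂ {L₁} ν
    with com₂ , com₁ ← Complementary-⊞⁻ L₂ μ₂ ν₂ com =
    trans (count-swap L₂ μ₂ μ₁ A)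
          (trans (balance bal (μ₁ ⊞ μ₂) (ν₁ ⊞ ν₂) (Complementary-⊞⁺ L₁ μ₁ ν₁ com₁ com₂))
                 (count-swap L₁ ν₁ ν₂ B))

  module _ {L₁ L₂ : List (Polygon n)} where

    -- `A` is the arc that stays on the side of `L₁`, and `I` consists of the vertices that belong
    -- only to the far side. The last hypothesis is balance of the far side at the ends of the
    -- diagonal.
    Balanced-saturated : ∀ {A B I} → All (Avoids L₂) A → All (Avoids L₁) I →
      Balanced L₁ A B → Balanced L₂ [] I → Balanced (L₁ ++ L₂) A (I ++ B)
    balance (Balanced-saturated {A} {B} {I} A∉ I∉ bal₁ bal₂) μ ν com
      with μ₁ , μ₂ , refl ← ⊞-surjective L₁ {L₂} μ
         | ν₁ , ν₂ , refl ← ⊞-surjective L₁ {L₂} ν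
      with com₁ , com₂ ← Complementary-⊞⁻ L₁ μ₁ ν₁ com = begin
      count (L₁ ++ L₂) (μ₁ ⊞ μ₂) A
        ≡⟨ count-↭ (Perm.↭-sym (Permₚ.++-identityʳ A)) (μ₁ ⊞ μ₂) ⟩
      count (L₁ ++ L₂) (μ₁ ⊞ μ₂) (A ++ [])
        ≡⟨ count-++ A∉ [] μ₁ μ₂ ⟩
      count L₁ μ₁ A * count L₂ μ₂ []
        ≡⟨ cong₂ _*_ (balance bal₁ μ₁ ν₁ com₁) (balance bal₂ μ₂ ν₂ com₂) ⟩
      count L₁ ν₁ B * count L₂ ν₂ I
        ≡⟨ sym (count-saturated I∉ B ν₁ ν₂ (Balanced-[]⇒sum≤ bal₂ {μ₂} com₂)) ⟩
      count (L₁ ++ L₂) (ν₁ ⊞ ν₂) (I ++ B) ∎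

    -- Here `A₁` runs from `i` to `b`, `A₂` from `b` to `j`, `B₂` from `j` to `a` and `B₁` from `a`
    -- to `i`. The diagonal makes `a` and `b` adjacent in both halves, so the arc from `i` to `a` in
    -- the first half is `A₁` together with `b`; the other three hypotheses arise likewise.
    Balanced-shared : ∀ {a b A₁ A₂ B₁ B₂} →
      All (Avoids L₂) A₁ → All (Avoids L₁) A₂ → All (Avoids L₂) B₁ → All (Avoids L₁) B₂ →
      Balanced L₁ (b ∷ A₁) B₁ → Balanced L₁ A₁ (a ∷ B₁) →
      Balanced L₂ (b ∷ A₂) B₂ → Balanced L₂ A₂ (a ∷ B₂) →
      Balanced (L₁ ++ L₂) (b ∷ A₁ ++ A₂) (a ∷ B₁ ++ B₂)
    balance (Balanced-shared {a} {b} {A₁} {A₂} {B₁} {B₂} A₁∉ A₂∉ B₁∉ B₂∉ b₁ a₁ b₂ a₂) μ ν com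
      with μ₁ , μ₂ , refl ← ⊞-surjective L₁ {L₂} μ
         | ν₁ , ν₂ , refl ← ⊞-surjective L₁ {L₂} ν
      with com₁ , com₂ ← Complementary-⊞⁻ L₁ μ₁ ν₁ com = begin
      count (L₁ ++ L₂) (μ₁ ⊞ μ₂) (b ∷ A₁ ++ A₂)
        ≡⟨ count-shared A₁∉ A₂∉ μ₁ μ₂ ⟩
      count L₁ μ₁ (b ∷ A₁) * count L₂ μ₂ A₂ + count L₁ μ₁ A₁ * count L₂ μ₂ (b ∷ A₂)
        ≡⟨ cong₂ _+_ (cong₂ _*_ (balance b₁ μ₁ ν₁ com₁) (balance a₂ μ₂ ν₂ com₂))
                     (cong₂ _*_ (balance a₁ μ₁ ν₁ com₁) (balance b₂ μ₂ ν₂ com₂)) ⟩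
      count L₁ ν₁ B₁ * count L₂ ν₂ (a ∷ B₂) + count L₁ ν₁ (a ∷ B₁) * count L₂ ν₂ B₂
        -- Where `b` draws from `L₁`, the complementary term has `a` drawing from `L₂`: the summands
        -- come out crossed.
        ≡⟨ +-comm (count L₁ ν₁ B₁ * _) _ ⟩
      count L₁ ν₁ (a ∷ B₁) * count L₂ ν₂ B₂ + count L₁ ν₁ B₁ * count L₂ ν₂ (a ∷ B₂)
        ≡⟨ sym (count-shared B₁∉ B₂∉ ν₁ ν₂) ⟩
      count (L₁ ++ L₂) (ν₁ ⊞ ν₂) (a ∷ B₁ ++ B₂) ∎

-- Facts on cyclic order, by checking all relative positions

∧-true : ∀ {b c} → b ∧ c ≡ true → b ≡ true × c ≡ true
∧-true {true} eq = refl , eq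

infixr 1 _⇒_
_⇒_ : Bool → Bool → Bool
b ⇒ c = not b ∨ c

modus-ponens : ∀ {b c} → (b ⇒ c) ≡ true → b ≡ true → c ≡ true
modus-ponens eq refl = eq

All-true : List Bool → Set
All-true []       = ⊤
All-true (b ∷ bs) = b ≡ true × All-true bs

and⇒All-true : ∀ bs → and bs ≡ true → All-true bs
and⇒All-true []       _  = tt
and⇒All-true (b ∷ bs) eq with b≡true , eq′ ← ∧-true {b} eq = b≡true , and⇒All-true bs eq′

-- For membership in three sets: the first is the disjoint union of the other two.
splits : Bool → Bool → Bool → Bool
splits p q r = if p then q xor r else not (q ∨ r)

agree : Bool → Bool → Bool
agree p q = not (p xor q)

-- The comparison is a parameter because the same formulas are read twice: for the vertices of P_n,
-- and for finite tables of comparisons when they are checked.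
module Order {A : Set} (_≺_ : A → A → Bool) where

  same : A → A → Bool
  same p q = not (p ≺ q) ∧ not (q ≺ p)

  -- q is met strictly between p and r when going counterclockwise from p
  between : A → A → A → Bool
  between p q r = (p ≺ q ∧ q ≺ r) ∨ (q ≺ r ∧ r ≺ p) ∨ (r ≺ p ∧ p ≺ q)

  side : A → A → A → Bool
  side a b k = same a k ∨ same b k ∨ between a k b

  -- i and j lie on the closed arc from a to b, in the order a, i, j, b
  Nested : A → A → A → A → Bool
  Nested a b i j = side a b i ∧ side a b j ∧ not (same a b) ∧ not (same i j)
    ∧ (same a i ∨ between a i j) ∧ (same j b ∨ between i j b)

  -- i lies strictly between a and b, and j strictly between b and a
  Separated : A → A → A → A → Bool
  Separated a b i j = between a i b ∧ between b j a ∧ not (same a b)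

  -- What `glue-nested` consumes: the location of both arcs relative to the diagonal, the exclusions
  -- behind `Avoids`, and the adjacency of `a` and `b` on the far side.
  nestedFacts : A → A → A → A → A → List Bool
  nestedFacts a b i j k =
      agree (between i k j) (side a b k ∧ between i k j)
    ∷ (side a b k ∧ between i k j ⇒ not (side b a k))
    ∷ splits (between j k i) (side b a k ∧ between b k a) (side a b k ∧ between j k i)
    ∷ (side b a k ∧ between b k a ⇒ not (side a b k))
    ∷ not (side b a k ∧ between a k b)
    ∷ side b a a ∷ side b a b
    ∷ []

  -- Six decompositions, four exclusions behind `Avoids`, then the side conditions for the induction
  -- hypotheses. The shared vertex is first kept with the part on the side of `i` and then split
  -- off.
  separatedFacts : A → A → A → A → A → List Bool
  separatedFacts a b i j k =
      splits (between i k j) (side a b k ∧ between i k a) (side b a k ∧ between b k j)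
    ∷ splits (side a b k ∧ between i k a) (same b k) (side a b k ∧ between i k b)
    ∷ splits (between j k i) (side a b k ∧ between b k i) (side b a k ∧ between j k a)
    ∷ splits (side a b k ∧ between b k i) (same a k) (side a b k ∧ between a k i)
    ∷ splits (side b a k ∧ between a k j) (same b k) (side b a k ∧ between b k j)
    ∷ splits (side b a k ∧ between j k b) (same a k) (side b a k ∧ between j k a)
    ∷ (side a b k ∧ between i k b ⇒ not (side b a k))
    ∷ (side b a k ∧ between b k j ⇒ not (side a b k))
    ∷ (side a b k ∧ between a k i ⇒ not (side b a k))
    ∷ (side b a k ∧ between j k a ⇒ not (side a b k))
    ∷ side a b a ∷ side a b b ∷ side a b i ∷ side b a a ∷ side b a b ∷ side b a j
    ∷ not (same i a) ∷ not (same i b) ∷ not (same b j) ∷ not (same a j)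
    ∷ []

  partitionFacts : A → A → A → List Bool
  partitionFacts i j k =
      splits true (same i k) (not (same i k))
    ∷ splits (not (same i k)) (same j k) (between i k j ∨ between j k i)
    ∷ splits (between i k j ∨ between j k i) (between i k j) (between j k i)
    ∷ []

  halvesFacts : A → A → A → List Bool
  halvesFacts a b k =
      agree (not (k ≺ a) ∧ not (b ≺ k)) (side a b k)
    ∷ agree (not (a ≺ k) ∨ not (k ≺ b)) (side b a k)
    ∷ []

  forwardFacts : A → A → A → List Bool
  forwardFacts i j k = agree (between i k j) (i ≺ k ∧ k ≺ j) ∷ []

  wrappingFacts : A → A → A → List Bool
  wrappingFacts i j k = splits (between i k j) (i ≺ k) (k ≺ j) ∷ []

  -- Nesting appears in all four versions. Separation is unchanged when `a` with `b` and `i` with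
  -- `j` are exchanged together, which leaves two versions.
  cases : A → A → A → A → Bool
  cases a b i j = not (same a b) ∧ not (same i j)
    ⇒ (Nested a b i j ∨ Nested a b j i) ∨ (Nested b a i j ∨ Nested b a j i)
       ∨ (Separated a b i j ∨ Separated a b j i)

-- Deciding order statements by ranks

module _ {m : ℕ} where

  -- A table rather than a function: pointwise equal comparisons then give equal tables, and `subst`
  -- applies without function extensionality.
  comparisons : (Fin m → ℕ) → Vec (Vec Bool m) m
  comparisons v = tabulate λ p → tabulate λ q → v p <ᵇ v q

  infix 9 _at_
  _at_ : Vec (Vec Bool m) m → Fin m → Fin m → Bool
  (M at p) q = lookup (lookup M p) q

  everyVec : ∀ l → (Vec (Fin m) l → Bool) → Bool
  everyVec zero    f = f []
  everyVec (suc l) f = all (λ r → everyVec l (f ∘ (r ∷_))) (allFin m)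

  everyVec⇒ : ∀ l {f} → everyVec l f ≡ true → ∀ rs → f rs ≡ true
  everyVec⇒ zero    eq []       = eq
  everyVec⇒ (suc l) eq (r ∷ rs) = everyVec⇒ l (all⇒ (allFin m) eq (∈-allFin r)) rs
    where
    all⇒ : ∀ {f : Fin m → Bool} xs → all f xs ≡ true → ∀ {y} → y ∈ xs → f y ≡ true
    all⇒ {f} (y ∷ _)  eq (here refl) with eq′ , _ ← ∧-true {f y} eq = eq′
    all⇒ {f} (y ∷ xs) eq (there y∈) with _ , eq′ ← ∧-true {f y} eq = all⇒ xs eq′ y∈

  tautology : ((Fin m → Fin m → Bool) → Bool) → Bool
  tautology Φ = everyVec m λ rs → Φ (comparisons (toℕ ∘ lookup rs) at_)

tally : ∀ {m} → (Fin m → Bool) → ℕ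
tally {zero}  f = 0
tally {suc m} f = [ f zero ] + tally (f ∘ suc)

tally-mono : ∀ {m} {f g : Fin m → Bool} → (∀ p → [ f p ] ≤ [ g p ]) → tally f ≤ tally g
tally-mono {zero}  f≤g = z≤n
tally-mono {suc m} f≤g = +-mono-≤ (f≤g zero) (tally-mono (f≤g ∘ suc))

tally-mono-< : ∀ {m} {f g : Fin m → Bool} → (∀ p → [ f p ] ≤ [ g p ]) →
               ∀ p → f p ≡ false → g p ≡ true → tally f < tally g
tally-mono-< {suc m} f≤g zero    fp gp rewrite fp | gp = s≤s (tally-mono (f≤g ∘ suc))
tally-mono-< {suc m} f≤g (suc p) fp gp =
  +-mono-≤-< (f≤g zero) (tally-mono-< (f≤g ∘ suc) p fp gp)

tally-true : ∀ m → tally {m} (λ _ → true) ≡ m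
tally-true zero    = refl
tally-true (suc m) = cong suc (tally-true m)

[]≤1 : ∀ b → [ b ] ≤ 1
[]≤1 true  = s≤s z≤n
[]≤1 false = z≤n

<ᵇ-true : ∀ {m n} → m < n → (m <ᵇ n) ≡ true
<ᵇ-true {m} {n} m<n with m <ᵇ n | <⇒<ᵇ m<n
... | true | _ = refl

<ᵇ-false : ∀ {m n} → n ≤ m → (m <ᵇ n) ≡ false
<ᵇ-false {m} {n} n≤m with m <ᵇ n in eq
... | false = refl
... | true  = ⊥-elim (<⇒≱ (<ᵇ⇒< m n (subst T (sym eq) tt)) n≤m)

module _ {m : ℕ} (v : Fin m → ℕ) where

  rankℕ : Fin m → ℕ
  rankℕ p = tally λ q → v q <ᵇ v p

  <ᵇ-mono : ∀ x {y z} → y ≤ z → [ x <ᵇ y ] ≤ [ x <ᵇ z ]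
  <ᵇ-mono x {y} {z} y≤z with x <? y
  ... | yes x<y rewrite <ᵇ-true x<y | <ᵇ-true (≤-trans x<y y≤z) = s≤s z≤n
  ... | no  x≮y rewrite <ᵇ-false (≮⇒≥ x≮y) = z≤n

  -- If `v p` is below `v q`, all entries below `v p` are below `v q`, and `p` itself is counted
  -- only for `q`. Otherwise the inclusion is reversed and the counts follow it.
  rankℕ-<ᵇ : ∀ p q → (v p <ᵇ v q) ≡ (rankℕ p <ᵇ rankℕ q)
  rankℕ-<ᵇ p q with v p <? v q
  ... | yes vp<vq = trans (<ᵇ-true vp<vq) (sym (<ᵇ-true
          (tally-mono-< (λ r → <ᵇ-mono (v r) (<⇒≤ vp<vq)) p
            (<ᵇ-false {v p} ≤-refl) (<ᵇ-true vp<vq))))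
  ... | no  vp≮vq = trans (<ᵇ-false (≮⇒≥ vp≮vq)) (sym (<ᵇ-false
          (tally-mono (λ r → <ᵇ-mono (v r) (≮⇒≥ vp≮vq)))))

  rankℕ< : ∀ p → rankℕ p < m
  rankℕ< p = subst (rankℕ p <_) (tally-true m)
    (tally-mono-< (λ q → []≤1 (v q <ᵇ v p)) p (<ᵇ-false {v p} ≤-refl) refl)

  rank : Fin m → Fin m
  rank p = fromℕ< (rankℕ< p)

  comparisons-rank : comparisons (toℕ ∘ lookup (tabulate rank)) ≡ comparisons v
  comparisons-rank = tabulate-cong λ p → tabulate-cong λ q →
    trans (cong₂ _<ᵇ_ (toℕ-rank p) (toℕ-rank q)) (sym (rankℕ-<ᵇ p q))
    where
    toℕ-rank : ∀ p → toℕ (lookup (tabulate rank) p) ≡ rankℕ p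
    toℕ-rank p = trans (cong toℕ (lookup∘tabulate rank p)) (Finₚ.toℕ-fromℕ< (rankℕ< p))

  -- Only the relative order of the m numbers matters, so they may be replaced
  -- by their ranks.
  tautology⇒ : ∀ Φ → tautology Φ ≡ true → Φ (comparisons v at_) ≡ true
  tautology⇒ Φ taut = subst (λ M → Φ (M at_) ≡ true) comparisons-rank
    (everyVec⇒ m taut (tabulate rank))

module _ {n : ℕ} where

  _<ᶠ_ : Fin n → Fin n → Bool
  p <ᶠ q = toℕ p <ᵇ toℕ q

  open Order _<ᶠ_ public

  -- Abstract, since unfolding these re-evaluates all m^m cases.
  abstract

    nested : ∀ a b i j → Nested a b i j ≡ true → ∀ k → All-true (nestedFacts a b i j k)
    nested a b i j nst k = and⇒All-true (nestedFacts a b i j k) (modus-ponens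
      (tautology⇒ (lookup (toℕ a ∷ toℕ b ∷ toℕ i ∷ toℕ j ∷ toℕ k ∷ []))
         (λ _≺_ → Order.Nested _≺_ 0F 1F 2F 3F ⇒ and (Order.nestedFacts _≺_ 0F 1F 2F 3F 4F)) refl)
      nst)

    separated : ∀ a b i j → Separated a b i j ≡ true → ∀ k → All-true (separatedFacts a b i j k)
    separated a b i j sep k = and⇒All-true (separatedFacts a b i j k) (modus-ponens
      (tautology⇒ (lookup (toℕ a ∷ toℕ b ∷ toℕ i ∷ toℕ j ∷ toℕ k ∷ []))
         (λ _≺_ → Order.Separated _≺_ 0F 1F 2F 3F ⇒ and (Order.separatedFacts _≺_ 0F 1F 2F 3F 4F)) refl)
      sep)

    partition : ∀ i j → not (same i j) ≡ true → ∀ k → All-true (partitionFacts i j k)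
    partition i j i≢j k = and⇒All-true (partitionFacts i j k) (modus-ponens
      (tautology⇒ (lookup (toℕ i ∷ toℕ j ∷ toℕ k ∷ []))
         (λ _≺_ → not (Order.same _≺_ 0F 1F) ⇒ and (Order.partitionFacts _≺_ 0F 1F 2F)) refl)
      i≢j)

    halves : ∀ a b → (a <ᶠ b) ≡ true → ∀ k → All-true (halvesFacts a b k)
    halves a b a<b k = and⇒All-true (halvesFacts a b k) (modus-ponens
      (tautology⇒ (lookup (toℕ a ∷ toℕ b ∷ toℕ k ∷ []))
         (λ _≺_ → 0F ≺ 1F ⇒ and (Order.halvesFacts _≺_ 0F 1F 2F)) refl)
      a<b)

    forward : ∀ i j → (i <ᶠ j) ≡ true → ∀ k → All-true (forwardFacts i j k)
    forward i j i<j k = and⇒All-true (forwardFacts i j k) (modus-ponens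
      (tautology⇒ (lookup (toℕ i ∷ toℕ j ∷ toℕ k ∷ []))
         (λ _≺_ → 0F ≺ 1F ⇒ and (Order.forwardFacts _≺_ 0F 1F 2F)) refl)
      i<j)

    wrapping : ∀ i j → (j <ᶠ i) ≡ true → ∀ k → All-true (wrappingFacts i j k)
    wrapping i j j<i k = and⇒All-true (wrappingFacts i j k) (modus-ponens
      (tautology⇒ (lookup (toℕ i ∷ toℕ j ∷ toℕ k ∷ []))
         (λ _≺_ → 1F ≺ 0F ⇒ and (Order.wrappingFacts _≺_ 0F 1F 2F)) refl)
      j<i)

    exhaustive : ∀ a b i j → cases a b i j ≡ true
    exhaustive a b i j = tautology⇒ (lookup (toℕ a ∷ toℕ b ∷ toℕ i ∷ toℕ j ∷ []))
      (λ _≺_ → Order.cases _≺_ 0F 1F 2F 3F) refl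

-- Gluing along a diagonal

module _ {a} {A : Set a} where

  filterᵇ-splits : ∀ {p q r : A → Bool} → (∀ k → splits (p k) (q k) (r k) ≡ true) → ∀ xs →
                   filterᵇ p xs ↭ filterᵇ q xs ++ filterᵇ r xs
  filterᵇ-splits                 spl []       = ↭-refl
  filterᵇ-splits {p} {q} {r} spl (x ∷ xs) with p x | q x | r x | spl x
  ... | true  | true  | false | _ = prep x (filterᵇ-splits spl xs)
  ... | true  | false | true  | _ =
    ↭-trans (prep x (filterᵇ-splits spl xs)) (↭-sym (Permₚ.shift x (filterᵇ q xs) _))
  ... | false | false | false | _ = filterᵇ-splits spl xs

  filterᵇ-cong : ∀ {p q : A → Bool} → (∀ k → p k ≡ q k) → ∀ xs → filterᵇ p xs ≡ filterᵇ q xs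
  filterᵇ-cong         p≗q []       = refl
  filterᵇ-cong {p} {q} p≗q (x ∷ xs) with p x | q x | p≗q x
  ... | true  | _ | refl = cong (x ∷_) (filterᵇ-cong p≗q xs)
  ... | false | _ | refl = filterᵇ-cong p≗q xs

  filterᵇ-∧ : ∀ (p q : A → Bool) xs → filterᵇ p (filterᵇ q xs) ≡ filterᵇ (λ k → q k ∧ p k) xs
  filterᵇ-∧ p q []       = refl
  filterᵇ-∧ p q (x ∷ xs) with q x
  ... | false = filterᵇ-∧ p q xs
  ... | true  with p x
  ...   | true  = cong (x ∷_) (filterᵇ-∧ p q xs)
  ...   | false = filterᵇ-∧ p q xs

  filterᵇ-none : ∀ {p : A → Bool} → (∀ k → not (p k) ≡ true) → ∀ xs → filterᵇ p xs ≡ []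
  filterᵇ-none     ¬p []       = refl
  filterᵇ-none {p} ¬p (x ∷ xs) with p x | ¬p x
  ... | false | _ = filterᵇ-none ¬p xs

  filterᵇ-true : ∀ (xs : List A) → filterᵇ (const true) xs ≡ xs
  filterᵇ-true []       = refl
  filterᵇ-true (x ∷ xs) = cong (x ∷_) (filterᵇ-true xs)

  All-filterᵇ : ∀ (p : A → Bool) xs → All (λ k → p k ≡ true) (filterᵇ p xs)
  All-filterᵇ p xs = All.map (Equivalence.to T-≡) (Allₚ.all-filter _ xs)

  length-filterᵇ-tabulate : ∀ {m} (p : A → Bool) (f : Fin m → A) →
    length (filterᵇ p (List.tabulate f)) ≡ ∣ tabulate (p ∘ f) ∣
  length-filterᵇ-tabulate {zero}  p f = refl
  length-filterᵇ-tabulate {suc m} p f with p (f zero)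
  ... | true  = cong suc (length-filterᵇ-tabulate p (f ∘ suc))
  ... | false = length-filterᵇ-tabulate p (f ∘ suc)

agree⇒≡ : ∀ {p q} → agree p q ≡ true → p ≡ q
agree⇒≡ {true}  {true}  _ = refl
agree⇒≡ {false} {false} _ = refl

not-true : ∀ {b} → not b ≡ true → b ≡ false
not-true {false} _ = refl

module _ {n : ℕ} where

  <ᶠ-irrefl : ∀ (p : Fin n) → (p <ᶠ p) ≡ false
  <ᶠ-irrefl p = <ᵇ-false {toℕ p} ≤-refl

  same-refl : ∀ (p : Fin n) → same p p ≡ true
  same-refl p rewrite <ᶠ-irrefl p = refl

  same⇒≡ : ∀ {p q : Fin n} → same p q ≡ true → p ≡ q
  same⇒≡ {p} {q} eq with <-cmp (toℕ p) (toℕ q)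
  ... | tri≈ _ p≡q _ = Finₚ.toℕ-injective p≡q
  ... | tri< p<q _ _ rewrite <ᵇ-true p<q with () ← eq
  ... | tri> _ _ q<p rewrite <ᵇ-true q<p | ∧-zeroʳ (not (p <ᶠ q)) with () ← eq

  filterᵇ-same : ∀ {a : Fin n} {xs} → Unique xs → a ∈ xs → filterᵇ (same a) xs ≡ a ∷ []
  filterᵇ-same {a} (a∉xs ∷ _) (here refl) rewrite same-refl a = cong (a ∷_) (rest a∉xs)
    where
    rest : ∀ {xs} → All (a ≢_) xs → filterᵇ (same a) xs ≡ []
    rest []                   = refl
    rest {x ∷ _} (a≢x ∷ a∉xs) with same a x in eq
    ... | true  = ⊥-elim (a≢x (same⇒≡ eq))
    ... | false = rest a∉xs
  filterᵇ-same {a} {x ∷ _} (x∉xs ∷ uniq) (there a∈xs) with same a x in eq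
  ... | true  = ⊥-elim (All.lookup x∉xs a∈xs (sym (same⇒≡ eq)))
  ... | false = filterᵇ-same uniq a∈xs

  vertices : Polygon n → List (Fin n)
  vertices Q = filterᵇ (lookup Q) (allFin n)

  filterᵇ-same-vertices : ∀ Q {a} → lookup Q a ≡ true → filterᵇ (same a) (vertices Q) ≡ a ∷ []
  filterᵇ-same-vertices Q {a} a∈Q = filterᵇ-same (Uniqueₚ.filter⁺ _ (Uniqueₚ.allFin⁺ n))
    (∈-filter⁺ (T? ∘ lookup Q) (∈-allFin a) (Equivalence.from T-≡ a∈Q))

  length-vertices : ∀ Q → length (vertices Q) ≡ ∣ Q ∣
  length-vertices Q =
    trans (length-filterᵇ-tabulate (lookup Q) id) (cong ∣_∣ (tabulate∘lookup Q))

  -- Listed by increasing label, whereas `arc` starts after `i`; the two are compared only up to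
  -- permutation.
  arcOf : Polygon n → Fin n → Fin n → List (Fin n)
  arcOf Q i j = filterᵇ (λ k → between i k j) (vertices Q)

  -- The induction statement: `L` plays the part of a dissection of `Q`.
  ArcsBalanced : List (Polygon n) → Polygon n → Set
  ArcsBalanced L Q = ∀ i j → lookup Q i ≡ true → lookup Q j ≡ true → not (same i j) ≡ true →
                     Balanced L (arcOf Q i j) (arcOf Q j i)

  PiecesWithin : List (Polygon n) → Polygon n → Set
  PiecesWithin L Q = ∀ v → lookup Q v ≡ false → Avoids L v

  -- Stated with cyclic sides, so that it is symmetric under exchanging the ends; `inner` and
  -- `outer` presuppose `a < b`.
  record IsCut (Q Q₁ Q₂ : Polygon n) (a b : Fin n) : Set where
    field
      a∈Q    : lookup Q a ≡ true
      b∈Q    : lookup Q b ≡ true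
      a≢b    : not (same a b) ≡ true
      a-to-b : ∀ k → lookup Q₁ k ≡ lookup Q k ∧ side a b k
      b-to-a : ∀ k → lookup Q₂ k ≡ lookup Q k ∧ side b a k

  same-sym : ∀ (a b : Fin n) → same a b ≡ same b a
  same-sym a b = ∧-comm (not (a <ᶠ b)) _

  IsCut-sym : ∀ {Q Q₁ Q₂ a b} → IsCut Q Q₁ Q₂ a b → IsCut Q Q₂ Q₁ b a
  IsCut-sym {a = a} {b} c = record
    { a∈Q = b∈Q ; b∈Q = a∈Q ; a≢b = trans (cong not (same-sym b a)) a≢b
    ; a-to-b = b-to-a ; b-to-a = a-to-b }
    where open IsCut c

  module _ {Q Q₁ Q₂ a b} (isCut : IsCut Q Q₁ Q₂ a b) where

    open IsCut isCut

    -- Arcs of the halves become filters of the one list `vertices Q`, where the order facts apply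
    -- pointwise.
    arcOf-cut : ∀ i j → arcOf Q₁ i j ≡ filterᵇ (λ k → side a b k ∧ between i k j) (vertices Q)
    arcOf-cut i j = begin
      filterᵇ (λ k → between i k j) (filterᵇ (lookup Q₁) (allFin n))
        ≡⟨ filterᵇ-∧ _ (lookup Q₁) (allFin n) ⟩
      filterᵇ (λ k → lookup Q₁ k ∧ between i k j) (allFin n)
        ≡⟨ filterᵇ-cong (λ k → trans (cong (_∧ between i k j) (a-to-b k))
                                     (∧-assoc (lookup Q k) _ _)) (allFin n) ⟩
      filterᵇ (λ k → lookup Q k ∧ side a b k ∧ between i k j) (allFin n)
        ≡⟨ sym (filterᵇ-∧ _ (lookup Q) (allFin n)) ⟩
      filterᵇ (λ k → side a b k ∧ between i k j) (vertices Q) ∎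

    ∈-cut : ∀ {k} → lookup Q k ≡ true → side a b k ≡ true → lookup Q₁ k ≡ true
    ∈-cut {k} k∈Q k∈side = trans (a-to-b k) (cong₂ _∧_ k∈Q k∈side)

    ∉-cut : ∀ {L} → PiecesWithin L Q₁ → ∀ {p} → (∀ k → (p k ⇒ not (side a b k)) ≡ true) → ∀ xs →
            All (Avoids L) (filterᵇ p xs)
    ∉-cut within {p} p⇒ xs = All.map
      (λ {k} pk → within k (trans (a-to-b k)
        (trans (cong (lookup Q k ∧_) (not-true (modus-ponens (p⇒ k) pk))) (∧-zeroʳ _))))
      (All-filterᵇ p xs)

  module _ {Q Q₁ Q₂ a b L₁ L₂} (isCut : IsCut Q Q₁ Q₂ a b)
           (within₁ : PiecesWithin L₁ Q₁) (within₂ : PiecesWithin L₂ Q₂)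
           (bal₁ : ArcsBalanced L₁ Q₁) (bal₂ : ArcsBalanced L₂ Q₂) where

    open IsCut isCut

    private
      U = vertices Q
      cut₁ = isCut
      cut₂ = IsCut-sym isCut

    glue-nested : ∀ i j → lookup Q i ≡ true → lookup Q j ≡ true → Nested a b i j ≡ true →
                  Balanced (L₁ ++ L₂) (arcOf Q i j) (arcOf Q j i)
    glue-nested i j i∈Q j∈Q nst
      with i∈ , nst₁ ← ∧-true {side a b i} nst
      with j∈ , nst₂ ← ∧-true {side a b j} nst₁
      with _ , nst₃ ← ∧-true {not (same a b)} nst₂
      with i≢j , _ ← ∧-true {not (same i j)} nst₃
      -- The two memberships do not involve the last argument; `i` only fills the place.
      with _ , _ , _ , _ , _ , a∈₂ , b∈₂ , _ ← nested a b i j nst i =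
      Balanced-↭
        (↭-reflexive (filterᵇ-cong (λ k → agree⇒≡ (proj₁ (facts k))) U))
        (filterᵇ-splits (λ k → let _ , _ , f , _ = facts k in f) U)
        (Balanced-saturated
          (∉-cut cut₂ within₂ (λ k → let _ , f , _ = facts k in f) U)
          (∉-cut cut₁ within₁ (λ k → let _ , _ , _ , f , _ = facts k in f) U)
          (subst₂ (Balanced L₁) (arcOf-cut cut₁ i j) (arcOf-cut cut₁ j i)
            (bal₁ i j (∈-cut cut₁ i∈Q i∈) (∈-cut cut₁ j∈Q j∈) i≢j))
          -- The hypothesis for the second half at the ends of the diagonal, where the arc from `a`
          -- to `b` is empty.
          (subst₂ (Balanced L₂)
            (trans (arcOf-cut cut₂ a b)
                   (filterᵇ-none (λ k → let _ , _ , _ , _ , f , _ = facts k in f) U))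
            (arcOf-cut cut₂ b a)
            (bal₂ a b (∈-cut cut₂ a∈Q a∈₂) (∈-cut cut₂ b∈Q b∈₂) a≢b)))
      where
      facts = nested a b i j nst

    glue-separated : ∀ i j → lookup Q i ≡ true → lookup Q j ≡ true → Separated a b i j ≡ true →
                     Balanced (L₁ ++ L₂) (arcOf Q i j) (arcOf Q j i)
    glue-separated i j i∈Q j∈Q sep
      with _ , _ , _ , _ , _ , _ , _ , _ , _ , _ ,
           a∈₁ , b∈₁ , i∈₁ , a∈₂ , b∈₂ , j∈₂ , i≢a , i≢b , b≢j , a≢j , _ ← separated a b i j sep i =
      Balanced-↭
        (↭-trans (filterᵇ-splits (λ k → let f , _ = facts k in f) U)
                 (Permₚ.++⁺ʳ A₂ b∷A₁))
        (↭-trans (filterᵇ-splits (λ k → let _ , _ , f , _ = facts k in f) U)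
                 (Permₚ.++⁺ʳ B₂ a∷B₁))
        (Balanced-shared
          (∉-cut cut₂ within₂ (λ k → let _ , _ , _ , _ , _ , _ , f , _ = facts k in f) U)
          (∉-cut cut₁ within₁ (λ k → let _ , _ , _ , _ , _ , _ , _ , f , _ = facts k in f) U)
          (∉-cut cut₂ within₂ (λ k → let _ , _ , _ , _ , _ , _ , _ , _ , f , _ = facts k in f) U)
          (∉-cut cut₁ within₁ (λ k → let _ , _ , _ , _ , _ , _ , _ , _ , _ , f , _ = facts k in f) U)
          -- The four instances join `i` in the first half, and `j` in the second, to each end of
          -- the diagonal.
          (Balanced-↭ (↭-sym (↭-trans (↭-reflexive (arcOf-cut cut₁ i a)) b∷A₁))
                      (↭-reflexive (sym (arcOf-cut cut₁ a i)))
                      (bal₁ i a (∈-cut cut₁ i∈Q i∈₁) (∈-cut cut₁ a∈Q a∈₁) i≢a))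
          (Balanced-↭ (↭-reflexive (sym (arcOf-cut cut₁ i b)))
                      (↭-sym (↭-trans (↭-reflexive (arcOf-cut cut₁ b i)) a∷B₁))
                      (bal₁ i b (∈-cut cut₁ i∈Q i∈₁) (∈-cut cut₁ b∈Q b∈₁) i≢b))
          (Balanced-↭ (↭-sym (↭-trans (↭-reflexive (arcOf-cut cut₂ a j)) b∷A₂))
                      (↭-reflexive (sym (arcOf-cut cut₂ j a)))
                      (bal₂ a j (∈-cut cut₂ a∈Q a∈₂) (∈-cut cut₂ j∈Q j∈₂) a≢j))
          (Balanced-↭ (↭-reflexive (sym (arcOf-cut cut₂ b j)))
                      (↭-sym (↭-trans (↭-reflexive (arcOf-cut cut₂ j b)) a∷B₂))
                      (bal₂ b j (∈-cut cut₂ b∈Q b∈₂) (∈-cut cut₂ j∈Q j∈₂) b≢j)))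
      where
      facts = separated a b i j sep
      on₁ on₂ : Fin n → Fin n → List (Fin n)
      on₁ p q = filterᵇ (λ k → side a b k ∧ between p k q) U
      on₂ p q = filterᵇ (λ k → side b a k ∧ between p k q) U
      A₂ = on₂ b j
      B₂ = on₂ j a
      single : ∀ {c} xs → lookup Q c ≡ true → filterᵇ (same c) U ++ xs ↭ c ∷ xs
      single xs c∈Q = ↭-reflexive (cong (_++ xs) (filterᵇ-same-vertices Q c∈Q))
      b∷A₁ : on₁ i a ↭ b ∷ on₁ i b
      b∷A₁ = ↭-trans (filterᵇ-splits (λ k → let _ , f , _ = facts k in f) U) (single _ b∈Q)
      a∷B₁ : on₁ b i ↭ a ∷ on₁ a i
      a∷B₁ = ↭-trans (filterᵇ-splits (λ k → let _ , _ , _ , f , _ = facts k in f) U) (single _ a∈Q)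
      b∷A₂ : on₂ a j ↭ b ∷ on₂ b j
      b∷A₂ = ↭-trans (filterᵇ-splits (λ k → let _ , _ , _ , _ , f , _ = facts k in f) U) (single _ b∈Q)
      a∷B₂ : on₂ j b ↭ a ∷ on₂ j a
      a∷B₂ = ↭-trans (filterᵇ-splits (λ k → let _ , _ , _ , _ , _ , f , _ = facts k in f) U) (single _ a∈Q)

  ∨-true : ∀ {p q} → p ∨ q ≡ true → p ≡ true ⊎ q ≡ true
  ∨-true {true}  _  = inj₁ refl
  ∨-true {false} eq = inj₂ eq

  glue : ∀ {Q Q₁ Q₂ a b L₁ L₂} → IsCut Q Q₁ Q₂ a b → PiecesWithin L₁ Q₁ → PiecesWithin L₂ Q₂ →
         ArcsBalanced L₁ Q₁ → ArcsBalanced L₂ Q₂ → ArcsBalanced (L₁ ++ L₂) Q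
  glue {Q} {Q₁} {Q₂} {a} {b} {L₁} {L₂} isCut within₁ within₂ bal₁ bal₂ i j i∈Q j∈Q i≢j
    with ∨-true {Nested a b i j ∨ Nested a b j i}
           (modus-ponens (exhaustive a b i j) (cong₂ _∧_ (IsCut.a≢b isCut) i≢j))
  ... | inj₁ nst with ∨-true {Nested a b i j} nst
  ...   | inj₁ nst₁ = glue-nested isCut within₁ within₂ bal₁ bal₂ i j i∈Q j∈Q nst₁
  ...   | inj₂ nst₂ = Balanced-sym (glue-nested isCut within₁ within₂ bal₁ bal₂ j i j∈Q i∈Q nst₂)
  glue {Q} {Q₁} {Q₂} {a} {b} {L₁} {L₂} isCut within₁ within₂ bal₁ bal₂ i j i∈Q j∈Q i≢j
      | inj₂ rest with ∨-true {Nested b a i j ∨ Nested b a j i} rest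
  ... | inj₁ nst with ∨-true {Nested b a i j} nst
  ...   | inj₁ nst₁ = Balanced-swap {L₁ = L₂} {L₂ = L₁}
                        (glue-nested (IsCut-sym isCut) within₂ within₁ bal₂ bal₁ i j i∈Q j∈Q nst₁)
  ...   | inj₂ nst₂ = Balanced-swap {L₁ = L₂} {L₂ = L₁} (Balanced-sym
                        (glue-nested (IsCut-sym isCut) within₂ within₁ bal₂ bal₁ j i j∈Q i∈Q nst₂))
  glue {Q} {Q₁} {Q₂} {a} {b} {L₁} {L₂} isCut within₁ within₂ bal₁ bal₂ i j i∈Q j∈Q i≢j
      | inj₂ rest | inj₂ sep with ∨-true {Separated a b i j} sep
  ... | inj₁ sep₁ = glue-separated isCut within₁ within₂ bal₁ bal₂ i j i∈Q j∈Q sep₁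
  ... | inj₂ sep₂ = Balanced-sym (glue-separated isCut within₁ within₂ bal₁ bal₂ j i j∈Q i∈Q sep₂)

  -- A single polygon

  count-single : ∀ (Q : Polygon n) e {S} → All (λ v → lookup Q v ≡ true) S → count (Q ∷ []) (e ∷ []) S ≡ δ₁ e (length S)
  count-single Q zero    []          = refl
  count-single Q (suc e) []          = refl
  count-single Q zero    (v∈Q ∷ S⊆Q) rewrite v∈Q = refl
  count-single Q (suc e) (v∈Q ∷ S⊆Q) rewrite v∈Q = trans (+-identityʳ _) (count-single Q e S⊆Q)

  -- Over each arc the product is a power of the only indeterminate. The two arcs miss exactly `i`
  -- and `j`, so their lengths add up to `∣ Q ∣ ∸ 2`.
  single-balanced : ∀ Q → ArcsBalanced (Q ∷ []) Q
  balance (single-balanced Q i j i∈Q j∈Q i≢j) (e ∷ []) (e′ ∷ []) (e+e′ , _) = begin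
    count (Q ∷ []) (e ∷ []) (arcOf Q i j)
      ≡⟨ count-single Q e (arc⊆Q i j) ⟩
    δ₁ e (length (arcOf Q i j))
      ≡⟨ δ₁-complement e e′ _ _ (trans e+e′ (cong (_∸ 2) ∣Q∣)) ⟩
    δ₁ e′ (length (arcOf Q j i))
      ≡⟨ sym (count-single Q e′ (arc⊆Q j i)) ⟩
    count (Q ∷ []) (e′ ∷ []) (arcOf Q j i) ∎
    where
    arc⊆Q : ∀ i j → All (λ v → lookup Q v ≡ true) (arcOf Q i j)
    arc⊆Q i j = Allₚ.filter⁺ _ (All-filterᵇ (lookup Q) (allFin n))
    U = vertices Q
    parts : U ↭ filterᵇ (same i) U ++ filterᵇ (same j) U ++ arcOf Q i j ++ arcOf Q j i
    parts = ↭-trans (↭-reflexive (sym (filterᵇ-true U)))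
      (↭-trans (filterᵇ-splits (λ k → proj₁ (partition i j i≢j k)) U)
      (Permₚ.++⁺ˡ (filterᵇ (same i) U)
      (↭-trans (filterᵇ-splits (λ k → proj₁ (proj₂ (partition i j i≢j k))) U)
      (Permₚ.++⁺ˡ (filterᵇ (same j) U)
      (filterᵇ-splits (λ k → proj₁ (proj₂ (proj₂ (partition i j i≢j k)))) U)))))
    ∣Q∣ : ∣ Q ∣ ≡ 2 + (length (arcOf Q i j) + length (arcOf Q j i))
    ∣Q∣ = begin
      ∣ Q ∣
        ≡⟨ sym (length-vertices Q) ⟩
      length U
        ≡⟨ Permₚ.↭-length parts ⟩
      length (filterᵇ (same i) U ++ filterᵇ (same j) U ++ arcOf Q i j ++ arcOf Q j i)
        ≡⟨ cong₂ (λ xs ys → length (xs ++ ys ++ arcOf Q i j ++ arcOf Q j i))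
             (filterᵇ-same-vertices Q i∈Q) (filterᵇ-same-vertices Q j∈Q) ⟩
      2 + length (arcOf Q i j ++ arcOf Q j i)
        ≡⟨ cong (2 +_) (length-++ (arcOf Q i j)) ⟩
      2 + (length (arcOf Q i j) + length (arcOf Q j i)) ∎

  subdivide : List (Segment n) → Polygon n → List (Polygon n)
  subdivide []       Q = Q ∷ []
  subdivide (s ∷ ss) Q = concatMap (subdivide ss) (cut s Q)

  -- `pieces` cuts all polygons by one segment after another; `subdivide` finishes one half before
  -- the other, which puts the pieces of the two halves into consecutive sublists, as gluing
  -- requires.
  foldl-cut : ∀ ss Qs → foldl (λ Qs s → concatMap (cut s) Qs) Qs ss ≡ concatMap (subdivide ss) Qs
  foldl-cut []       Qs = sym (concatMap-pure Qs)
  foldl-cut (s ∷ ss) Qs = trans (foldl-cut ss (concatMap (cut s) Qs)) (concatMap-concatMap Qs)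
    where
    concatMap-concatMap : ∀ Qs → concatMap (subdivide ss) (concatMap (cut s) Qs)
                                 ≡ concatMap (subdivide (s ∷ ss)) Qs
    concatMap-concatMap []       = refl
    concatMap-concatMap (Q ∷ Qs) =
      trans (concatMap-++ (subdivide ss) (cut s Q) _)
            (cong (subdivide (s ∷ ss) Q ++_) (concatMap-concatMap Qs))

  ≤ᵇ-not-<ᵇ : ∀ p q → (p ≤ᵇ q) ≡ not (q <ᵇ p)
  ≤ᵇ-not-<ᵇ zero    q             = refl
  ≤ᵇ-not-<ᵇ (suc p) zero          = refl
  ≤ᵇ-not-<ᵇ (suc zero) (suc q)    = refl
  ≤ᵇ-not-<ᵇ (suc (suc p)) (suc q) = ≤ᵇ-not-<ᵇ (suc p) q

  lookup-inner : ∀ (a b : Fin n) → (a <ᶠ b) ≡ true → ∀ k → lookup (inner (a , b)) k ≡ side a b k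
  lookup-inner a b a<b k = trans (lookup∘tabulate _ k)
    (trans (cong₂ _∧_ (≤ᵇ-not-<ᵇ (toℕ a) (toℕ k)) (≤ᵇ-not-<ᵇ (toℕ k) (toℕ b)))
           (agree⇒≡ (proj₁ (halves a b a<b k))))

  lookup-outer : ∀ (a b : Fin n) → (a <ᶠ b) ≡ true → ∀ k → lookup (outer (a , b)) k ≡ side b a k
  lookup-outer a b a<b k = trans (lookup∘tabulate _ k)
    (trans (cong₂ _∨_ (≤ᵇ-not-<ᵇ (toℕ k) (toℕ a)) (≤ᵇ-not-<ᵇ (toℕ b) (toℕ k)))
           (agree⇒≡ (proj₁ (proj₂ (halves a b a<b k)))))

  diagonal-isCut : ∀ {Q a b} → IsDiagonalOf Q (a , b) →
                   IsCut Q (Q ∩ inner (a , b)) (Q ∩ outer (a , b)) a b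
  diagonal-isCut {Q} {a} {b} (a∈Q , b∈Q , (_ , _ , a<k , k<b) , _) = record
    { a∈Q = []=⇒lookup a∈Q
    ; b∈Q = []=⇒lookup b∈Q
    ; a≢b = cong (λ c → not (not c ∧ not (b <ᶠ a))) a<ᶠb
    ; a-to-b = λ k → trans (lookup-zipWith _∧_ k Q _) (cong (lookup Q k ∧_) (lookup-inner a b a<ᶠb k))
    ; b-to-a = λ k → trans (lookup-zipWith _∧_ k Q _) (cong (lookup Q k ∧_) (lookup-outer a b a<ᶠb k))
    }
    where
    a<ᶠb : (a <ᶠ b) ≡ true
    a<ᶠb = <ᵇ-true (<-trans a<k k<b)

  subdivide-within : ∀ ss Q → PiecesWithin (subdivide ss Q) Q
  subdivide-within []       Q v v∉Q = v∉Q ∷ []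
  subdivide-within (s ∷ ss) Q v v∉Q with does (isDiagonalOf? Q s)
  ... | false = Allₚ.++⁺ (subdivide-within ss Q v v∉Q) []
  ... | true  = Allₚ.++⁺ (subdivide-within ss _ v (∉∩ (inner s)))
                  (Allₚ.++⁺ (subdivide-within ss _ v (∉∩ (outer s))) [])
    where
    ∉∩ : ∀ R → lookup (Q ∩ R) v ≡ false
    ∉∩ R = trans (lookup-zipWith _∧_ v Q R) (cong (_∧ lookup R v) v∉Q)

  -- Both halves receive all remaining segments, and `cut` passes over those that are not diagonals
  -- of the half at hand.
  subdivide-balanced : ∀ ss Q → ArcsBalanced (subdivide ss Q) Q
  subdivide-balanced []       Q = single-balanced Q
  subdivide-balanced (s ∷ ss) Q = step (isDiagonalOf? Q s)
    where
    step : (d : Dec (IsDiagonalOf Q s)) →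
           ArcsBalanced (concatMap (subdivide ss)
             (if does d then Q ∩ inner s ∷ Q ∩ outer s ∷ [] else Q ∷ [])) Q
    step (no _)     = subst (λ L → ArcsBalanced L Q) (sym (++-identityʳ _)) (subdivide-balanced ss Q)
    step (yes diag) =
      subst (λ L → ArcsBalanced (subdivide ss (Q ∩ inner s) ++ L) Q) (sym (++-identityʳ _))
        (glue (diagonal-isCut diag) (subdivide-within ss _) (subdivide-within ss _)
              (subdivide-balanced ss (Q ∩ inner s)) (subdivide-balanced ss (Q ∩ outer s)))

-- Walks as assignments

module _ {a p} {A : Set a} {P : Pred A p} (P? : Decidable P) where

  filter≡filterᵇ : ∀ xs → filter P? xs ≡ filterᵇ (does ∘ P?) xs
  filter≡filterᵇ []       = refl
  filter≡filterᵇ (x ∷ xs) with does (P? x)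
  ... | true  = cong (x ∷_) (filter≡filterᵇ xs)
  ... | false = filter≡filterᵇ xs

  ∑-filter : ∀ xs (f : A → ℕ) → ∑ (filter P? xs) f ≡ ∑ xs (λ x → [ does (P? x) ] * f x)
  ∑-filter []       f = refl
  ∑-filter (x ∷ xs) f with does (P? x)
  ... | true  = cong₂ _+_ (sym (+-identityʳ (f x))) (∑-filter xs f)
  ... | false = ∑-filter xs f

[∧] : ∀ b c → [ b ∧ c ] ≡ [ b ] * [ c ]
[∧] true  c = sym (+-identityʳ _)
[∧] false c = refl

δ₁-≟ : ∀ d e → [ does (d ≟ e) ] ≡ δ₁ d e
δ₁-≟ zero    zero    = refl
δ₁-≟ zero    (suc e) = refl
δ₁-≟ (suc d) zero    = refl
δ₁-≟ (suc d) (suc e) = δ₁-≟ d e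

δ-≟ : ∀ {m} (μ ν : Monomial m) → [ does (≡-dec _≟_ μ ν) ] ≡ δ μ ν
δ-≟ []      []      = refl
δ-≟ (d ∷ μ) (e ∷ ν) =
  trans ([∧] (does (d ≟ e)) _) (cong₂ _*_ (δ₁-≟ d e) (δ-≟ μ ν))

-- The factor `δ μ ν` removes the term unless `μ ≡ ν`, so the equivalence may rely on that equation.
[]*δ-cong : ∀ {A B : Set} (A? : Dec A) (B? : Dec B) {m} (μ ν : Monomial m) → (μ ≡ ν → A ⇔ B) →
            [ does A? ] * δ μ ν ≡ [ does B? ] * δ μ ν
[]*δ-cong A? B? μ ν A⇔B rewrite sym (δ-≟ μ ν) with ≡-dec _≟_ μ ν
... | yes μ≡ν = cong (λ b → [ b ] * 1) (does-⇔ (A⇔B μ≡ν) A? B?)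
... | no _    = trans (*-zeroʳ [ does A? ]) (sym (*-zeroʳ [ does B? ]))

zeros-· : ∀ {m} (μ : Monomial m) → tabulate (const 0) · μ ≡ μ
zeros-· []      = refl
zeros-· (e ∷ μ) = cong (e ∷_) (zeros-· μ)

∈?-lookup : ∀ {n} (v : Fin n) (Q : Polygon n) → does (v ∈? Q) ≡ lookup Q v
∈?-lookup zero    (true  ∷ Q) = refl
∈?-lookup zero    (false ∷ Q) = refl
∈?-lookup (suc v) (_ ∷ Q)     = ∈?-lookup v Q

module _ {n : ℕ} where

  exponents : ∀ {L : List (Polygon n)} → Usage L → Monomial (length L)
  exponents []      = []
  exponents (e ∷ μ) = e ∷ exponents μ

  usage : ∀ (L : List (Polygon n)) → Monomial (length L) → Usage L
  usage []      []      = []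
  usage (Q ∷ L) (e ∷ ν) = e ∷ usage L ν

  exponents-usage : ∀ L ν → exponents (usage L ν) ≡ ν
  exponents-usage []      []      = refl
  exponents-usage (Q ∷ L) (e ∷ ν) = cong (e ∷_) (exponents-usage L ν)

  -- The bound makes the truncated subtraction exact and so yields the additive relation used in the
  -- induction.
  usage-complementary : ∀ L (ν : Monomial (length L)) →
    (∀ l → lookup ν l ≤ ∣ List.lookup L l ∣ ∸ 2) →
    Complementary L (usage L (tabulate λ l → ∣ List.lookup L l ∣ ∸ 2 ∸ lookup ν l)) (usage L ν)
  usage-complementary []      []      ν≤ = tt
  usage-complementary (Q ∷ L) (e ∷ ν) ν≤ = m∸n+n≡m (ν≤ zero) , usage-complementary L ν (ν≤ ∘ suc)

  δ₀≡δ-one : ∀ {L} (μ : Usage L) → δ₀ μ ≡ δ one (exponents μ)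
  δ₀≡δ-one []      = refl
  δ₀≡δ-one (e ∷ μ) = cong (δ₁ 0 e *_) (δ₀≡δ-one μ)

  -- An adjunction: lowering `μ` by a step at `v` matches multiplying `κ` by the indeterminate of a
  -- piece incident to `v`.
  ∑-uses-δ : ∀ L v (μ : Usage L) κ → ∑ (uses L v μ) (λ μ′ → δ κ (exponents μ′))
    ≡ ∑ (allFin (length L)) (λ l → [ lookup (List.lookup L l) v ] * δ (x l · κ) (exponents μ))
  ∑-uses-δ []      v []      []      = refl
  ∑-uses-δ (Q ∷ L) v (e ∷ μ) (d ∷ κ) = begin
    ∑ (uses (Q ∷ L) v (e ∷ μ)) (λ μ′ → δ (d ∷ κ) (exponents μ′))
      ≡⟨ ∑-uses-∷ Q L v e μ _ ⟩
    ∑ (preds (lookup Q v) e) (λ e′ → δ₁ d e′ * δ κ (exponents μ))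
      + ∑ (uses L v μ) (λ μ′ → δ₁ d e * δ κ (exponents μ′))
      ≡⟨ cong₂ _+_ (first (lookup Q v) e) rest ⟩
    term zero + ∑ (allFin (length L)) (term ∘ suc)
      ≡⟨ cong (term zero +_) (sym (∑-map suc (allFin (length L)) term)) ⟩
    term zero + ∑ (map suc (allFin (length L))) term
      ≡⟨ cong (λ ls → term zero + ∑ ls term) (map-tabulate id suc) ⟩
    ∑ (allFin (length (Q ∷ L))) term ∎
    where
    term : Fin (length (Q ∷ L)) → ℕ
    term l = [ lookup (List.lookup (Q ∷ L) l) v ] * δ (x l · (d ∷ κ)) (e ∷ exponents μ)

    first : ∀ b e → ∑ (preds b e) (λ e′ → δ₁ d e′ * δ κ (exponents μ))
                    ≡ [ b ] * (δ₁ (suc d) e * δ (tabulate (const 0) · κ) (exponents μ))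
    first false e       = refl
    first true  zero    = refl
    first true  (suc e) rewrite zeros-· κ = refl

    rest : ∑ (uses L v μ) (λ μ′ → δ₁ d e * δ κ (exponents μ′))
           ≡ ∑ (allFin (length L)) (term ∘ suc)
    rest = begin
      ∑ (uses L v μ) (λ μ′ → δ₁ d e * δ κ (exponents μ′))
        ≡⟨ ∑-*ˡ (δ₁ d e) (uses L v μ) _ ⟩
      δ₁ d e * ∑ (uses L v μ) (λ μ′ → δ κ (exponents μ′))
        ≡⟨ cong (δ₁ d e *_) (∑-uses-δ L v μ κ) ⟩
      δ₁ d e * ∑ (allFin (length L)) _
        ≡⟨ sym (∑-*ˡ (δ₁ d e) (allFin (length L)) _) ⟩
      ∑ (allFin (length L))
        (λ l → δ₁ d e * ([ lookup (List.lookup L l) v ] * δ (x l · κ) (exponents μ)))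
        ≡⟨ ∑-cong (allFin (length L))
             (λ l → x∙yz≈y∙xz (δ₁ d e) [ lookup (List.lookup L l) v ] _) ⟩
      ∑ (allFin (length L)) (term ∘ suc) ∎

  module _ (L : List (Polygon n)) where

    incident? : Decidable₂ (λ (k : Fin n) l → k Subset.∈ List.lookup L l)
    incident? k l = k ∈? List.lookup L l

    weightOf : List (Fin (length L)) → Monomial (length L)
    weightOf = foldr (λ l μ → x l · μ) one

    -- Expands the product: a sequence of pieces is one choice of a term in each factor.
    count≡∑ : ∀ S (μ : Usage L) → count L μ S ≡ ∑ (sequences (length L) (length S))
      (λ p → [ does (Pointwise.decidable incident? S p) ] * δ (weightOf p) (exponents μ))
    count≡∑ []      μ = begin
      δ₀ μ                              ≡⟨ δ₀≡δ-one μ ⟩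
      δ one (exponents μ)               ≡⟨ sym (trans (+-identityʳ _) (+-identityʳ _)) ⟩
      1 * δ one (exponents μ) + 0       ∎
    count≡∑ (v ∷ S) μ = begin
      ∑ (uses L v μ) (λ μ′ → count L μ′ S)
        ≡⟨ ∑-cong (uses L v μ) (count≡∑ S) ⟩
      ∑ (uses L v μ) (λ μ′ → ∑ seqs (λ p → inc p * δ (weightOf p) (exponents μ′)))
        ≡⟨ ∑-swap (uses L v μ) seqs _ ⟩
      ∑ seqs (λ p → ∑ (uses L v μ) (λ μ′ → inc p * δ (weightOf p) (exponents μ′)))
        ≡⟨ ∑-cong seqs (λ p → trans (∑-*ˡ (inc p) (uses L v μ) _)
             (trans (cong (inc p *_) (∑-uses-δ L v μ (weightOf p)))
                    (sym (∑-*ˡ (inc p) labels _)))) ⟩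
      ∑ seqs (λ p → ∑ labels (λ l →
        inc p * ([ lookup (List.lookup L l) v ] * δ (weightOf (l ∷ p)) (exponents μ))))
        ≡⟨ ∑-swap seqs labels _ ⟩
      ∑ labels (λ l → ∑ seqs (λ p →
        inc p * ([ lookup (List.lookup L l) v ] * δ (weightOf (l ∷ p)) (exponents μ))))
        ≡⟨ ∑-cong labels (λ l → trans (∑-cong seqs (λ p → prepend l p))
                                       (sym (∑-map (l ∷_) seqs summand))) ⟩
      ∑ labels (λ l → ∑ (map (l ∷_) seqs) summand)
        ≡⟨ sym (∑-concatMap (λ l → map (l ∷_) seqs) labels summand) ⟩
      ∑ (sequences (length L) (length (v ∷ S))) summand ∎
      where
      seqs = sequences (length L) (length S)
      labels = allFin (length L)
      inc : List (Fin (length L)) → ℕ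
      inc p = [ does (Pointwise.decidable incident? S p) ]
      summand : List (Fin (length L)) → ℕ
      summand p = [ does (Pointwise.decidable incident? (v ∷ S) p) ] * δ (weightOf p) (exponents μ)
      prepend : ∀ l p → inc p * ([ lookup (List.lookup L l) v ] * δ (weightOf (l ∷ p)) (exponents μ))
                        ≡ summand (l ∷ p)
      prepend l p = begin
        inc p * ([ lookup (List.lookup L l) v ] * D)
          ≡⟨ x∙yz≈yx∙z (inc p) [ lookup (List.lookup L l) v ] D ⟩
        [ lookup (List.lookup L l) v ] * inc p * D
          ≡⟨ cong (λ b → [ b ] * inc p * D) (sym (∈?-lookup v (List.lookup L l))) ⟩
        [ does (incident? v l) ] * inc p * D
          ≡⟨ cong (_* D) (sym ([∧] (does (incident? v l)) _)) ⟩
        summand (l ∷ p) ∎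
        where D = δ (weightOf (l ∷ p)) (exponents μ)

  arc↭arcOf : ∀ {i j : Fin n} → i ≢ j → arc i j ↭ arcOf Subset.⊤ i j
  arc↭arcOf {i} {j} i≢j = ↭-trans arc↭ (↭-reflexive (cong (filterᵇ _) (sym vertices-⊤)))
    where
    vertices-⊤ : vertices {n} Subset.⊤ ≡ allFin n
    vertices-⊤ = trans (filterᵇ-cong (λ k → lookup-replicate k true) (allFin n))
                       (filterᵇ-true (allFin n))
    arc↭ : arc i j ↭ filterᵇ (λ k → between i k j) (allFin n)
    arc↭ with <-cmp (toℕ i) (toℕ j)
    ... | tri≈ _ i≡j _ = ⊥-elim (i≢j (Finₚ.toℕ-injective i≡j))
    ... | tri< i<j _ _ rewrite <ᵇ-true i<j = ↭-reflexive
          (trans (filter≡filterᵇ (λ k → (i Finₚ.<? k) ×-dec (k Finₚ.<? j)) (allFin n))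
                 (sym (filterᵇ-cong (λ k → agree⇒≡ (proj₁ (forward i j (<ᵇ-true i<j) k))) (allFin n))))
    ... | tri> _ _ j<i rewrite <ᵇ-false (<⇒≤ j<i) = ↭-trans
          (↭-reflexive (cong₂ _++_ (filter≡filterᵇ (i Finₚ.<?_) (allFin n))
                                   (filter≡filterᵇ (Finₚ._<? j) (allFin n))))
          (↭-sym (filterᵇ-splits (λ k → proj₁ (wrapping i j (<ᵇ-true j<i) k)) (allFin n)))

-- Coefficients of the weight matrix

coeff-map : ∀ {a} {A : Set a} {m} (h : A → Monomial m) ps ν →
            coeff (map (λ p → 1ℤ , h p) ps) ν ≡ ℤ.+ ∑ ps (λ p → δ (h p) ν)
coeff-map h []       ν = refl
coeff-map h (p ∷ ps) ν rewrite sym (δ-≟ (h p) ν) with does (≡-dec _≟_ (h p) ν)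
... | true  = cong (λ c → 1ℤ ℤ.+ c) (coeff-map h ps ν)
... | false = coeff-map h ps ν

module _ {n : ℕ} (D : Dissection n) where

  open Dissection D

  Bounded : Monomial (#pieces D) → Set
  Bounded ν = ∀ l → lookup ν l ≤ degree D l ∸ 2

  pieces≡subdivide : pieces D ≡ subdivide diagonals Subset.⊤
  pieces≡subdivide = trans (foldl-cut diagonals (Subset.⊤ ∷ [])) (++-identityʳ _)

  pieces-balanced : ∀ {i j} → i ≢ j → Balanced (pieces D) (arc i j) (arc j i)
  pieces-balanced {i} {j} i≢j = Balanced-↭ (arc↭arcOf i≢j) (arc↭arcOf (i≢j ∘ sym))
    (subst (λ L → ArcsBalanced L Subset.⊤) (sym pieces≡subdivide)
      (subdivide-balanced diagonals Subset.⊤) i j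
      (lookup-replicate i true) (lookup-replicate j true) i≢ᵇj)
    where
    i≢ᵇj : not (same i j) ≡ true
    i≢ᵇj with same i j in eq
    ... | true  = ⊥-elim (i≢j (same⇒≡ eq))
    ... | false = refl

  w≡map : ∀ ps → foldr (λ p f → ⟦ weight D p ⟧ ⊕ f) 𝟘 ps ≡ map (λ p → 1ℤ , weight D p) ps
  w≡map []       = refl
  w≡map (p ∷ ps) = cong (_ ∷_) (w≡map ps)

  coeff-w : ∀ i j ν → coeff (w D i j) ν ≡ ℤ.+ ∑ (walks D i j) (λ p → δ (weight D p) ν)
  coeff-w i j ν = trans (cong (λ f → coeff f ν) (w≡map (walks D i j)))
                        (coeff-map (weight D) (walks D i j) ν)

  coeff-φw : ∀ i j ν → coeff (proj₁ (φ D (W D i j))) ν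
                       ≡ ℤ.+ ∑ (walks D i j) (λ p → δ (complement D (weight D p)) ν)
  coeff-φw i j ν = begin
    coeff (map _ (w D i j)) ν
      ≡⟨ cong (λ f → coeff (map _ f) ν) (w≡map (walks D i j)) ⟩
    coeff (map _ (map _ (walks D i j))) ν
      ≡⟨ cong (λ f → coeff f ν) (sym (map-∘ (walks D i j))) ⟩
    coeff (map (λ p → 1ℤ , complement D (weight D p)) (walks D i j)) ν
      ≡⟨ coeff-map (complement D ∘ weight D) (walks D i j) ν ⟩
    ℤ.+ ∑ (walks D i j) (λ p → δ (complement D (weight D p)) ν) ∎

  -- The exponents of a weight are the occurrence numbers of the pieces. A sequence of weight `ν`
  -- thus meets the bound on occurrences exactly because `ν` is bounded.
  ∑-walks : ∀ {i j} → i ≢ j → ∀ {ν} → Bounded ν →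
    ∑ (walks D i j) (λ p → δ (weight D p) ν) ≡ count (pieces D) (usage (pieces D) ν) (arc i j)
  ∑-walks {i} {j} i≢j {ν} ν≤ = begin
    ∑ (walks D i j) (λ p → δ (weight D p) ν)
      ≡⟨ ∑-filter (isWalk? D i j) seqs _ ⟩
    ∑ seqs (λ p → [ does (isWalk? D i j p) ] * δ (weight D p) ν)
      ≡⟨ ∑-cong seqs same-term ⟩
    ∑ seqs (λ p → [ does (incident p) ] * δ (weight D p) ν)
      ≡⟨ ∑-cong seqs (λ p → cong (λ κ → [ does (incident p) ] * δ (weight D p) κ)
                              (sym (exponents-usage (pieces D) ν))) ⟩
    ∑ seqs (λ p → [ does (incident p) ] * δ (weight D p) (exponents (usage (pieces D) ν)))
      ≡⟨ sym (count≡∑ (pieces D) (arc i j) (usage (pieces D) ν)) ⟩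
    count (pieces D) (usage (pieces D) ν) (arc i j) ∎
    where
    seqs = sequences (#pieces D) (length (arc i j))
    incident : ∀ p → Dec (Pointwise (λ k l → k Subset.∈ piece D l) (arc i j) p)
    incident = Pointwise.decidable (incident? (pieces D)) (arc i j)
    same-term : ∀ p → [ does (isWalk? D i j p) ] * δ (weight D p) ν
                      ≡ [ does (incident p) ] * δ (weight D p) ν
    same-term p = []*δ-cong (isWalk? D i j p) (incident p) (weight D p) ν λ weight≡ν → mk⇔
      (proj₁ ∘ proj₂)
      (λ inc → i≢j , inc , λ l → subst (_≤ degree D l ∸ 2)
        (trans (cong (λ μ → lookup μ l) (sym weight≡ν)) (lookup-weight D p l)) (ν≤ l))

  complement-bounded : ∀ ν → Bounded (complement D ν)
  complement-bounded ν l = subst (_≤ degree D l ∸ 2) (sym (lookup∘tabulate _ l))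
    (m∸n≤m (degree D l ∸ 2) (lookup ν l))

  complement-involutive : ∀ ν → Bounded ν → complement D (complement D ν) ≡ ν
  complement-involutive ν ν≤ = trans
    (tabulate-cong (λ l → trans (cong (degree D l ∸ 2 ∸_) (lookup∘tabulate _ l)) (m∸[m∸n]≡n (ν≤ l))))
    (tabulate∘lookup ν)

  -- Complementation is an involution on bounded monomials; beyond the bound `∸` would truncate.
  δ-complement : ∀ μ ν → Bounded μ → Bounded ν → δ (complement D μ) ν ≡ δ μ (complement D ν)
  δ-complement μ ν μ≤ ν≤ = begin
    δ (complement D μ) ν                           ≡⟨ sym (δ-≟ (complement D μ) ν) ⟩
    [ does (≡-dec _≟_ (complement D μ) ν) ]        ≡⟨ cong [_] (does-⇔ (mk⇔
        (λ { refl → sym (complement-involutive μ μ≤) })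
        (λ { refl → complement-involutive ν ν≤ }))
        (≡-dec _≟_ (complement D μ) ν) (≡-dec _≟_ μ (complement D ν))) ⟩
    [ does (≡-dec _≟_ μ (complement D ν)) ]        ≡⟨ δ-≟ μ (complement D ν) ⟩
    δ μ (complement D ν)                           ∎

  walks-bounded : ∀ i j → All (Bounded ∘ weight D) (walks D i j)
  walks-bounded i j = All.map
    (λ {p} (_ , _ , occ≤) l → subst (_≤ degree D l ∸ 2) (sym (lookup-weight D p l)) (occ≤ l))
    (Allₚ.all-filter (isWalk? D i j) (sequences (#pieces D) (length (arc i j))))

  coeff-complement : ∀ {i j} → i ≢ j → ∀ {ν} → Bounded ν →
                     coeff (proj₁ (φ D (W D i j))) ν ≡ coeff (w D j i) ν
  coeff-complement {i} {j} i≢j {ν} ν≤ = begin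
    coeff (proj₁ (φ D (W D i j))) ν
      ≡⟨ coeff-φw i j ν ⟩
    ℤ.+ ∑ (walks D i j) (λ p → δ (complement D (weight D p)) ν)
      ≡⟨ cong ℤ.+_ (begin
           ∑ (walks D i j) (λ p → δ (complement D (weight D p)) ν)
             ≡⟨ ∑-congᴬ (All.map (λ {p} μ≤ → δ-complement (weight D p) ν μ≤ ν≤) (walks-bounded i j)) ⟩
           ∑ (walks D i j) (λ p → δ (weight D p) (complement D ν))
             ≡⟨ ∑-walks i≢j (complement-bounded ν) ⟩
           count (pieces D) (usage (pieces D) (complement D ν)) (arc i j)
             ≡⟨ balance (pieces-balanced i≢j) _ _ (usage-complementary (pieces D) ν ν≤) ⟩
           count (pieces D) (usage (pieces D) ν) (arc j i)
             ≡⟨ sym (∑-walks (i≢j ∘ sym) ν≤) ⟩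
           ∑ (walks D j i) (λ p → δ (weight D p) ν) ∎) ⟩
    ℤ.+ ∑ (walks D j i) (λ p → δ (weight D p) ν)
      ≡⟨ sym (coeff-w j i ν) ⟩
    coeff (w D j i) ν ∎

  walks-self : ∀ i → walks D i i ≡ []
  walks-self i = filter-none (isWalk? D i i)
    (All.universal (λ _ isWalk → proj₁ isWalk refl) (sequences (#pieces D) (length (arc i i))))

  coeff-self : ∀ i ν → coeff (proj₁ (φ D (W D i i))) ν ≡ coeff (w D i i) ν
  coeff-self i ν = begin
    coeff (proj₁ (φ D (W D i i))) ν
      ≡⟨ coeff-φw i i ν ⟩
    ℤ.+ ∑ (walks D i i) (λ p → δ (complement D (weight D p)) ν)
      ≡⟨ cong (λ ps → ℤ.+ ∑ ps (λ p → δ (complement D (weight D p)) ν)) (walks-self i) ⟩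
    0ℤ
      ≡⟨ cong (λ ps → ℤ.+ ∑ ps (λ p → δ (weight D p) ν)) (sym (walks-self i)) ⟩
    ℤ.+ ∑ (walks D i i) (λ p → δ (weight D p) ν)
      ≡⟨ sym (coeff-w i i ν) ⟩
    coeff (w D i i) ν ∎

  coeff-unbounded : (f : Pol D) → ∀ ν → ¬ Bounded ν → coeff (proj₁ f) ν ≡ 0ℤ
  coeff-unbounded (f , f≤) ν ν≰ =
    decidable-stable (coeff f ν ℤₚ.≟ 0ℤ) (λ c≢0 → ν≰ (f≤ ν c≢0))

  bounded? : ∀ ν → Dec (Bounded ν)
  bounded? ν = Finₚ.all? (λ l → lookup ν l ≤? degree D l ∸ 2)

theorem3p5 : (n : ℕ) → 3 ≤ n → (D : Dissection n) → (i j : Fin n) →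
    proj₁ (φ D (W D i j)) ≈ proj₁ (W D j i)
theorem3p5 n _ D i j ν = compare (i Finₚ.≟ j) (bounded? D ν)
  where
  compare : Dec (i ≡ j) → Dec (Bounded D ν) →
            coeff (proj₁ (φ D (W D i j))) ν ≡ coeff (proj₁ (W D j i)) ν
  -- A separate case, as `arc i i` consists of all vertices but `i`; both sides vanish because there
  -- is no walk.
  compare (yes refl) _        = coeff-self D i ν
  compare (no i≢j)   (yes ν≤) = coeff-complement D i≢j ν≤
  -- Both polynomials respect the degree bound, so both coefficients are 0.
  compare (no _)     (no ν≰)  =
    trans (coeff-unbounded D (φ D (W D i j)) ν ν≰) (sym (coeff-unbounded D (W D j i) ν ν≰))
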